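{- Let $A,B\in 2^\omega$. If $A\not\le_T B$, then for every wtt-reduction $\Phi$ there exists $X\in 2^\omega$ such that $\dim_{si\Delta^0_1(A)}(X)=1$ and, either $\Phi^X$ is not total or $\dim_{si\Delta^0_1(B)}(\Phi^X)=0$.
   Context: Reals are elements of $2^\omega$, identified with subsets of $\omega$. $\le_T$ is Turing reducibility. For $X\in 2^\omega$, $X\upharpoonright n$ is the prefix of $X$ of length $n$, and $K$ denotes prefix-free Kolmogorov complexity. For an oracle $Y\in 2^\omega$, $$\dim_{si\Delta^0_1(Y)}(X)=\sup_{N}\ \inf_{n\in N}\frac{K(X\upharpoonright n)}{n},$$ where $N$ ranges over all infinite $\Delta^0_1(Y)$ (that is, $Y$-computable) subsets of $\omega$. Quotients are considered only for $n\ge 1$. A wtt-reduction (weak truth-table reduction) is an oracle machine $\Phi$ (with $\{0,1\}$-valued outputs) for which there is a computable function $f$ such that for every oracle $X$ and every $n$ the use of $\Phi^X(n)$ is bounded by $f(n)$; $\Phi^X(n)$ is not guaranteed to halt. When $\Phi^X$ is total it is regarded as an element of $2^\omega$. -}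

module Defs where

open import Data.Bool.Base using (Bool; true; false; if_then_else_)
open import Data.Fin.Base using (Fin)
open import Data.Integer.Base using (+_)
open import Data.List.Base using (List; []; _∷_; length; applyUpTo)
open import Data.List.Relation.Binary.Prefix.Heterogeneous using (Prefix)
open import Data.Nat.Base using (ℕ; suc; _+_; _*_; _≤_; _⊔_; NonZero)
open import Data.Product.Base using (∃-syntax; _×_)
open import Data.Rational.Base as ℚ using (ℚ)
open import Data.Vec.Base using (Vec; []; _∷_; [_]; lookup)
open import Function.Bundles using (_⇔_)
open import Relation.Binary.PropositionalEquality.Core using (_≡_)

2^ω : Set
2^ω = ℕ → Bool

bit : Bool → ℕ
bit b = if b then 1 else 0

_↾_ : 2^ω → ℕ → List Bool
X ↾ n = applyUpTo X n

-- Oracle machines are Kleene's schemes for partial recursive functions,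
-- together with the characteristic function of the oracle.

data Code : ℕ → Set where
  zero   : Code 0
  succ   : Code 1
  oracle : Code 1
  proj   : ∀ {k} → Fin k → Code k
  comp   : ∀ {k m} → Code m → Vec (Code k) m → Code k
  prec   : ∀ {k} → Code k → Code (2 + k) → Code (suc k)
  min    : ∀ {k} → Code (suc k) → Code k

infix 4 _⊢_∙_⇓_ _⊢_∙_⇓*_ _⊢_∙_from_⇓_

-- X ⊢ c ∙ xs ⇓ y is the type of halting computations of c with oracle X on
-- input xs and output y.  X ⊢ c ∙ xs from i ⇓ y is the search for the least
-- y ≥ i with c (y ∷ xs) = 0, all earlier values being defined and nonzero.

mutual
  data _⊢_∙_⇓_ (X : 2^ω) : ∀ {k} → Code k → Vec ℕ k → ℕ → Set where
    ⇓zero   : X ⊢ zero ∙ [] ⇓ 0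
    ⇓succ   : ∀ {n} → X ⊢ succ ∙ [ n ] ⇓ suc n
    ⇓oracle : ∀ {n} → X ⊢ oracle ∙ [ n ] ⇓ bit (X n)
    ⇓proj   : ∀ {k} {i : Fin k} {xs} → X ⊢ proj i ∙ xs ⇓ lookup xs i
    ⇓comp   : ∀ {k m} {c : Code m} {cs : Vec (Code k) m} {xs ys z} →
              X ⊢ cs ∙ xs ⇓* ys → X ⊢ c ∙ ys ⇓ z → X ⊢ comp c cs ∙ xs ⇓ z
    ⇓prec-z : ∀ {k} {c : Code k} {d xs y} →
              X ⊢ c ∙ xs ⇓ y → X ⊢ prec c d ∙ 0 ∷ xs ⇓ y
    ⇓prec-s : ∀ {k} {c : Code k} {d n xs y z} →
              X ⊢ prec c d ∙ n ∷ xs ⇓ y → X ⊢ d ∙ n ∷ y ∷ xs ⇓ z →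
              X ⊢ prec c d ∙ suc n ∷ xs ⇓ z
    ⇓min    : ∀ {k} {c : Code (suc k)} {xs y} →
              X ⊢ c ∙ xs from 0 ⇓ y → X ⊢ min c ∙ xs ⇓ y

  data _⊢_∙_⇓*_ (X : 2^ω) {k} : ∀ {m} → Vec (Code k) m → Vec ℕ k → Vec ℕ m → Set where
    []  : ∀ {xs} → X ⊢ [] ∙ xs ⇓* []
    _∷_ : ∀ {m c} {cs : Vec (Code k) m} {xs y ys} →
          X ⊢ c ∙ xs ⇓ y → X ⊢ cs ∙ xs ⇓* ys → X ⊢ c ∷ cs ∙ xs ⇓* y ∷ ys

  data _⊢_∙_from_⇓_ (X : 2^ω) {k} (c : Code (suc k)) (xs : Vec ℕ k) : ℕ → ℕ → Set where
    found : ∀ {i} → X ⊢ c ∙ i ∷ xs ⇓ 0 → X ⊢ c ∙ xs from i ⇓ i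
    next  : ∀ {i z y} → X ⊢ c ∙ i ∷ xs ⇓ suc z → X ⊢ c ∙ xs from suc i ⇓ y →
            X ⊢ c ∙ xs from i ⇓ y

-- One more than the largest oracle query made, and 0 if there is none.

mutual
  use : ∀ {X k} {c : Code k} {xs y} → X ⊢ c ∙ xs ⇓ y → ℕ
  use ⇓zero           = 0
  use ⇓succ           = 0
  use (⇓oracle {n})   = suc n
  use ⇓proj           = 0
  use (⇓comp ds e)    = use* ds ⊔ use e
  use (⇓prec-z d)     = use d
  use (⇓prec-s d e)   = use d ⊔ use e
  use (⇓min s)        = useˢ s

  use* : ∀ {X k m} {cs : Vec (Code k) m} {xs ys} → X ⊢ cs ∙ xs ⇓* ys → ℕ
  use* []       = 0
  use* (d ∷ ds) = use d ⊔ use* ds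

  useˢ : ∀ {X k} {c : Code (suc k)} {xs i y} → X ⊢ c ∙ xs from i ⇓ y → ℕ
  useˢ (found d)  = use d
  useˢ (next d s) = use d ⊔ useˢ s

infix 4 _[_]≐_ _≤T_

_[_]≐_ : Code 1 → 2^ω → 2^ω → Set
Φ [ X ]≐ Z = ∀ n → X ⊢ Φ ∙ [ n ] ⇓ bit (Z n)

Total : Code 1 → 2^ω → Set
Total Φ X = ∀ n → ∃[ y ] X ⊢ Φ ∙ [ n ] ⇓ y

_≤T_ : 2^ω → 2^ω → Set
X ≤T Y = ∃[ Φ ] Φ [ Y ]≐ X

-- Computability without an oracle is computability from the empty set.

∅ : 2^ω
∅ _ = false

Computable : (ℕ → ℕ) → Set
Computable f = ∃[ c ] (∀ n → ∅ ⊢ c ∙ [ n ] ⇓ f n)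

record WttReduction : Set where
  field
    machine    : Code 1
    binary     : ∀ {X n y} → X ⊢ machine ∙ [ n ] ⇓ y → ∃[ b ] y ≡ bit b
    bound      : ℕ → ℕ
    computable : Computable bound
    use≤bound  : ∀ {X n y} (d : X ⊢ machine ∙ [ n ] ⇓ y) → use d ≤ bound n

-- Bijective base 2, so that unary codes are exactly the partial computable
-- functions from strings to strings.

⌜_⌝ : List Bool → ℕ
⌜ [] ⌝        = 0
⌜ false ∷ σ ⌝ = 1 + 2 * ⌜ σ ⌝
⌜ true  ∷ σ ⌝ = 2 + 2 * ⌜ σ ⌝

infix 4 _⟨_⟩≃_

_⟨_⟩≃_ : Code 1 → List Bool → List Bool → Set
M ⟨ σ ⟩≃ τ = ∅ ⊢ M ∙ [ ⌜ σ ⌝ ] ⇓ ⌜ τ ⌝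

-- All numbers are codes of strings, so this is prefix-freeness of the domain.

PrefixFree : Code 1 → Set
PrefixFree M = ∀ {σ σ′ τ τ′} → M ⟨ σ ⟩≃ τ → M ⟨ σ′ ⟩≃ τ′ → Prefix _≡_ σ σ′ → σ ≡ σ′

-- Universality up to an additive constant, which is what makes K well defined
-- up to an additive constant; it is implied by universality by adjunction.

record UniversalPrefixFree (U : Code 1) : Set where
  field
    prefixFree : PrefixFree U
    universal  : ∀ M → PrefixFree M →
                 ∃[ c ] (∀ σ τ → M ⟨ σ ⟩≃ τ → ∃[ ρ ] (U ⟨ ρ ⟩≃ τ × length ρ ≤ length σ + c))

infix 4 K[_]_≡_

-- The graph of prefix-free complexity with respect to U.

K[_]_≡_ : Code 1 → List Bool → ℕ → Set
K[ U ] τ ≡ k = (∃[ σ ] (U ⟨ σ ⟩≃ τ × length σ ≡ k)) × (∀ σ → U ⟨ σ ⟩≃ τ → k ≤ length σ)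

-- An extended real, given by the set of rationals strictly below it.

LowerReal : Set₁
LowerReal = ℚ → Set

infix 4 _≈_

_≈_ : LowerReal → LowerReal → Set
x ≈ y = ∀ q → x q ⇔ y q

fromℚ : ℚ → LowerReal
fromℚ r q = q ℚ.< r

⨆ : {I : Set} → (I → LowerReal) → LowerReal
⨆ x q = ∃[ i ] x i q

-- The bare intersection of the cuts may have a greatest element.

⨅ : {I : Set} → (I → LowerReal) → LowerReal
⨅ x q = ∃[ r ] (q ℚ.< r × (∀ i → x i r))

Infinite : 2^ω → Set
Infinite N = ∀ m → ∃[ n ] (m ≤ n × N n ≡ true)

record InfiniteΔ⁰₁ (Y : 2^ω) : Set where
  field
    set        : 2^ω
    infinite   : Infinite set
    computable : set ≤T Y

record Quotient (U : Code 1) (X N : 2^ω) : Set where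
  field
    n           : ℕ
    {{nonZero}} : NonZero n
    n∈N         : N n ≡ true
    k           : ℕ
    complexity  : K[ U ] (X ↾ n) ≡ k

  value : ℚ
  value = (+ k) ℚ./ n

dim-siΔ⁰₁ : (U : Code 1) (Y X : 2^ω) → LowerReal
dim-siΔ⁰₁ U Y X =
  ⨆ λ (N : InfiniteΔ⁰₁ Y) →
  ⨅ λ (p : Quotient U X (InfiniteΔ⁰₁.set N)) →
  fromℚ (Quotient.value p)

{-# OPTIONS --safe #-}
module Submission where

open import Axiom.ExcludedMiddle using (ExcludedMiddle)
open import Data.Bool.Base using (Bool; true; false; not; _∧_; if_then_else_)
open import Data.Bool.Properties using (T-≡; ¬-not)
open import Data.Fin.Base using (Fin; zero; suc; inject₁; fromℕ; fromℕ<; toℕ)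
open import Data.Fin.Properties using (pigeonhole; toℕ<n; toℕ-fromℕ<)
open import Data.Integer.Base as ℤ using (0ℤ; -1ℤ)
import Data.Integer.Properties as ℤ
open import Data.List.Base using (List; []; _∷_; length; _++_; replicate)
open import Data.List.Properties using (∷-injectiveˡ; ∷-injectiveʳ; length-applyUpTo; length-++; length-replicate)
open import Data.List.Relation.Binary.Prefix.Heterogeneous using (Prefix; []; _∷_)
open import Data.Nat.Base
open import Data.Nat.DivMod using (_/_; _%_; m≡m%n+[m/n]*n; m%n<n; m/n*n≤m)
open import Data.Nat.Properties
open import Data.Nat.Tactic.RingSolver using (solve-∀)
open import Data.Product.Base using (Σ-syntax; ∃-syntax; _×_; _,_; proj₁; proj₂)
open import Data.Rational.Base as ℚ using (0ℚ; 1ℚ; ↥_; ↧_; ↧ₙ_)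
import Data.Rational.Properties as ℚ
import Data.Rational.Unnormalised.Base as ℚᵘ
import Data.Rational.Unnormalised.Properties as ℚᵘ
open import Data.Sum.Base using (_⊎_; inj₁; inj₂; [_,_]′; map₂)
open import Data.Vec.Base using (Vec; []; _∷_; lookup; _∷ʳ_)
open import Function.Base using (_∘_)
open import Function.Bundles using (mk⇔; module Equivalence)
open import Level using (0ℓ)
open import Relation.Binary.Definitions using (tri<; tri≈; tri>)
open import Relation.Binary.PropositionalEquality
open import Relation.Nullary.Decidable.Core using (yes; no; does; decidable-stable; toSum)
open import Relation.Nullary.Negation.Core using (¬_; contradiction)
open import Defs

-- Cut ω into blocks growing so fast that Φ on the first n bits only queries X within one block
-- beyond the block of n. Let X vanish except in the blocks whose number is,
-- in binary, a prefix of A, lowest digit first, with a leading 1; such a block contains a string,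
-- much longer than all that precedes it, which no shorter program can produce. The ends of these strings form
-- an A-computable set on which K(X ↾ n) / n tends to 1. If almost all elements of an infinite
-- B-computable set N lay in such blocks, A would be read off the block numbers, so A ≤T B.
-- Hence infinitely many n ∈ N lie in other blocks; there X is zero on all that Φ queries, except
-- for an initial segment negligible in comparison with n, and K(Φ^X ↾ n) / n is arbitrarily small.
-- Upper bounds on K come from machines that search for a preimage under an injective computable
-- encoding whose range is prefix-free, so that nothing has to be decoded.

-- Evaluation

mutual
  ⇓-deterministic : ∀ {X k} {c : Code k} {xs y z} → X ⊢ c ∙ xs ⇓ y → X ⊢ c ∙ xs ⇓ z → y ≡ z
  ⇓-deterministic ⇓zero         ⇓zero           = refl
  ⇓-deterministic ⇓succ         ⇓succ           = refl
  ⇓-deterministic ⇓oracle       ⇓oracle         = refl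
  ⇓-deterministic ⇓proj         ⇓proj           = refl
  ⇓-deterministic (⇓comp ds d)  (⇓comp es e)    with refl ← ⇓*-deterministic ds es = ⇓-deterministic d e
  ⇓-deterministic (⇓prec-z d)   (⇓prec-z e)     = ⇓-deterministic d e
  ⇓-deterministic (⇓prec-s d d′) (⇓prec-s e e′) with refl ← ⇓-deterministic d e = ⇓-deterministic d′ e′
  ⇓-deterministic (⇓min d)      (⇓min e)        = from-deterministic d e

  ⇓*-deterministic : ∀ {X k m} {cs : Vec (Code k) m} {xs ys zs} →
                     X ⊢ cs ∙ xs ⇓* ys → X ⊢ cs ∙ xs ⇓* zs → ys ≡ zs
  ⇓*-deterministic []       []       = refl
  ⇓*-deterministic (d ∷ ds) (e ∷ es) = cong₂ _∷_ (⇓-deterministic d e) (⇓*-deterministic ds es)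

  from-deterministic : ∀ {X k} {c : Code (suc k)} {xs i y z} →
                       X ⊢ c ∙ xs from i ⇓ y → X ⊢ c ∙ xs from i ⇓ z → y ≡ z
  from-deterministic (found d)  (found e)  = refl
  from-deterministic (found d)  (next e _) with () ← ⇓-deterministic d e
  from-deterministic (next d _) (found e)  with () ← ⇓-deterministic d e
  from-deterministic (next _ d) (next _ e) = from-deterministic d e

from-⇓0 : ∀ {X k} {c : Code (suc k)} {xs i y} → X ⊢ c ∙ xs from i ⇓ y → X ⊢ c ∙ y ∷ xs ⇓ 0
from-⇓0 (found d)  = d
from-⇓0 (next _ s) = from-⇓0 s

-- Unbounded search

-- Zero stands for truth, as in the scheme `min`; an inequality m ≤ n is then tested by whether
-- `m ∸ n` vanishes.
record Least (P : ℕ → ℕ) (y : ℕ) : Set where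
  constructor least
  field
    zeroAt  : P y ≡ 0
    minimal : ∀ {j} → j < y → P j ≢ 0

open Least

Least-≤ : ∀ {P y j} → Least P y → P j ≡ 0 → y ≤ j
Least-≤ l Pj = ≮⇒≥ (λ j<y → minimal l j<y Pj)

least? : ∀ P b → (∃[ y ] Least P y) ⊎ (∀ {j} → j < b → P j ≢ 0)
least? P zero    = inj₂ λ ()
least? P (suc b) with least? P b
... | inj₁ l = inj₁ l
... | inj₂ P≢0 with P b in Pb
...   | zero  = inj₁ (b , least Pb P≢0)
...   | suc _ = inj₂ λ {j} j<1+b Pj → case-≤ j (m≤n⇒m<n∨m≡n (s≤s⁻¹ j<1+b)) Pj
  where
  case-≤ : ∀ j → j < b ⊎ j ≡ b → P j ≢ 0
  case-≤ j (inj₁ j<b)  Pj = P≢0 j<b Pj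
  case-≤ j (inj₂ refl) Pj with () ← trans (sym Pb) Pj

abstract

  findLeast : ∀ P → ∃[ y ] P y ≡ 0 → ∃[ y ] Least P y
  findLeast P (y , Py) with least? P (suc y)
  ... | inj₁ l   = l
  ... | inj₂ P≢0 = contradiction Py (P≢0 ≤-refl)

from-least : ∀ {X k} {c : Code (suc k)} {xs P y} → (∀ i → X ⊢ c ∙ i ∷ xs ⇓ P i) →
             Least P y → X ⊢ c ∙ xs from 0 ⇓ y
from-least {X} {c = c} {xs} {P} {y} d l = search y 0 (+-identityʳ y)
  where
  -- The recursion is on the distance t that is left between i and y.
  search : ∀ t i → t + i ≡ y → X ⊢ c ∙ xs from i ⇓ y
  search zero    i refl = found (subst (X ⊢ c ∙ i ∷ xs ⇓_) (zeroAt l) (d i))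
  search (suc t) i eq with P i in Pi
  ... | zero  = contradiction Pi (minimal l (subst (i <_) eq (s≤s (m≤n+m i t))))
  ... | suc z = next (subst (X ⊢ c ∙ i ∷ xs ⇓_) Pi (d i)) (search t (suc i) (trans (+-suc t i) eq))

-- Total programs

-- A code is bundled with the total function it computes, so composites are correct by construction
-- and only their function remains to be identified.
record Program (Y : 2^ω) (k : ℕ) : Set where
  field
    code    : Code k
    ⟦_⟧     : Vec ℕ k → ℕ
    correct : ∀ xs → Y ⊢ code ∙ xs ⇓ ⟦_⟧ xs

open Program

module _ {Y : 2^ω} where

  -- Changes the denotation and keeps the code, so that values of later programs reduce to a named
  -- function instead of its recursion.
  computing : ∀ {k} (p : Program Y k) (f : Vec ℕ k → ℕ) → (∀ xs → ⟦ p ⟧ xs ≡ f xs) → Program Y k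
  computing p f eq = record
    { code    = code p
    ; ⟦_⟧     = f
    ; correct = λ xs → subst (Y ⊢ code p ∙ xs ⇓_) (eq xs) (correct p xs)
    }

  var : ∀ {k} → Fin k → Program Y k
  var i = record { code = proj i ; ⟦_⟧ = λ xs → lookup xs i ; correct = λ _ → ⇓proj }

  codes : ∀ {k m} → Vec (Program Y k) m → Vec (Code k) m
  codes []       = []
  codes (p ∷ ps) = code p ∷ codes ps

  ⟦_⟧* : ∀ {k m} → Vec (Program Y k) m → Vec ℕ k → Vec ℕ m
  ⟦ []     ⟧* xs = []
  ⟦ p ∷ ps ⟧* xs = ⟦ p ⟧ xs ∷ ⟦ ps ⟧* xs

  correct* : ∀ {k m} (ps : Vec (Program Y k) m) xs → Y ⊢ codes ps ∙ xs ⇓* ⟦ ps ⟧* xs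
  correct* []       xs = []
  correct* (p ∷ ps) xs = correct p xs ∷ correct* ps xs

  call : ∀ {k m} → Program Y m → Vec (Program Y k) m → Program Y k
  call p ps = record
    { code    = comp (code p) (codes ps)
    ; ⟦_⟧     = λ xs → ⟦ p ⟧ (⟦ ps ⟧* xs)
    ; correct = λ xs → ⇓comp (correct* ps xs) (correct p (⟦ ps ⟧* xs))
    }

  rec : ∀ {k} → Program Y k → Program Y (2 + k) → Program Y (suc k)
  rec {k} p s = record { code = prec (code p) (code s) ; ⟦_⟧ = f ; correct = eval }
    where
    f : Vec ℕ (suc k) → ℕ
    f (zero  ∷ xs) = ⟦ p ⟧ xs
    f (suc n ∷ xs) = ⟦ s ⟧ (n ∷ f (n ∷ xs) ∷ xs)

    eval : ∀ xs → Y ⊢ prec (code p) (code s) ∙ xs ⇓ f xs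
    eval (zero  ∷ xs) = ⇓prec-z (correct p xs)
    eval (suc n ∷ xs) = ⇓prec-s (eval (n ∷ xs)) (correct s _)

  search : ∀ {k} (p : Program Y (suc k)) → (∀ xs → ∃[ y ] Least (λ i → ⟦ p ⟧ (i ∷ xs)) y) → Program Y k
  search p l = record
    { code    = min (code p)
    ; ⟦_⟧     = λ xs → proj₁ (l xs)
    ; correct = λ xs → ⇓min (from-least (λ i → correct p (i ∷ xs)) (proj₂ (l xs)))
    }

  sucₚ : ∀ {k} → Program Y k → Program Y k
  sucₚ p = call (record { code = succ ; ⟦_⟧ = λ { (n ∷ []) → suc n } ; correct = λ { (_ ∷ []) → ⇓succ } }) (p ∷ [])

  lit : ∀ {k} → ℕ → Program Y k
  lit n = computing (numeral n) (λ _ → n) (eq n)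
    where
    numeral : ∀ {k} → ℕ → Program Y k
    numeral zero    = call (record { code = zero ; ⟦_⟧ = λ { [] → 0 } ; correct = λ { [] → ⇓zero } }) []
    numeral (suc n) = sucₚ (numeral n)
    eq : ∀ {k} n xs → ⟦ numeral {k} n ⟧ xs ≡ n
    eq zero    xs = refl
    eq (suc n) xs = cong suc (eq n xs)

  apply₁ : ∀ {k} (f : ℕ → ℕ) (p : Program Y 1) → (∀ n → ⟦ p ⟧ (n ∷ []) ≡ f n) →
           Program Y k → Program Y k
  apply₁ f p eq q = call (computing p (λ { (n ∷ []) → f n }) (λ { (n ∷ []) → eq n })) (q ∷ [])

  apply₂ : ∀ {k} (f : ℕ → ℕ → ℕ) (p : Program Y 2) → (∀ m n → ⟦ p ⟧ (m ∷ n ∷ []) ≡ f m n) →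
           Program Y k → Program Y k → Program Y k
  apply₂ f p eq q q′ =
    call (computing p (λ { (m ∷ n ∷ []) → f m n }) (λ { (m ∷ n ∷ []) → eq m n })) (q ∷ q′ ∷ [])

  infixl 6 _+ₚ_ _∸ₚ_
  infixl 7 _*ₚ_

  _+ₚ_ _*ₚ_ _∸ₚ_ : ∀ {k} → Program Y k → Program Y k → Program Y k

  _+ₚ_ = apply₂ _+_ p eq
    where
    p = rec (var zero) (sucₚ (var (suc zero)))
    eq : ∀ m n → ⟦ p ⟧ (m ∷ n ∷ []) ≡ m + n
    eq zero    n = refl
    eq (suc m) n = cong suc (eq m n)

  _*ₚ_ = apply₂ _*_ p eq
    where
    p = rec (lit 0) (var (suc (suc zero)) +ₚ var (suc zero))
    eq : ∀ m n → ⟦ p ⟧ (m ∷ n ∷ []) ≡ m * n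
    eq zero    n = refl
    eq (suc m) n = cong (n +_) (eq m n)

  predₚ : ∀ {k} → Program Y k → Program Y k
  predₚ = apply₁ pred (rec (lit 0) (var zero)) λ { zero → refl ; (suc _) → refl }

  -- The recursion is on the subtrahend, hence the exchanged arguments.
  p ∸ₚ q = apply₂ (λ n m → m ∸ n) r eq q p
    where
    r = rec (var zero) (predₚ (var (suc zero)))
    eq : ∀ n m → ⟦ r ⟧ (n ∷ m ∷ []) ≡ m ∸ n
    eq zero    m = refl
    eq (suc n) m = trans (cong pred (eq n m)) (pred[m∸n]≡m∸[1+n] m n)

  2^ₚ_ : ∀ {k} → Program Y k → Program Y k
  2^ₚ_ = apply₁ (2 ^_) p eq
    where
    p = rec (lit 1) (lit 2 *ₚ var (suc zero))
    eq : ∀ n → ⟦ p ⟧ (n ∷ []) ≡ 2 ^ n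
    eq zero    = refl
    eq (suc n) = cong (2 *_) (eq n)

  -- Equality in the form of a zero test, ready for unbounded search.
  distance : ∀ {k} → Program Y k → Program Y k → Program Y k
  distance p q = (p ∸ₚ q) +ₚ (q ∸ₚ p)

distance≡0 : ∀ m n → (m ∸ n) + (n ∸ m) ≡ 0 → m ≡ n
distance≡0 m n eq = ≤-antisym (m∸n≡0⇒m≤n (m+n≡0⇒m≡0 (m ∸ n) eq)) (m∸n≡0⇒m≤n (m+n≡0⇒n≡0 (m ∸ n) eq))

distance-refl : ∀ n → (n ∸ n) + (n ∸ n) ≡ 0
distance-refl n = cong₂ _+_ (n∸n≡0 n) (n∸n≡0 n)

-- Binary digits

odd : ℕ → Bool
odd zero    = false
odd (suc n) = not (odd n)

-- Halving by primitive recursion, so that `halfₚ` follows it clause by clause.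
half : ℕ → ℕ
half zero    = 0
half (suc n) = half n + bit (odd n)

digit : ℕ → 2^ω
digit n zero    = odd n
digit n (suc j) = digit (half n) j

bit-not : ∀ b → bit (not b) ≡ 1 ∸ bit b
bit-not false = refl
bit-not true  = refl

bit≤1 : ∀ b → bit b ≤ 1
bit≤1 false = z≤n
bit≤1 true  = ≤-refl

bit-injective : ∀ {a b} → bit a ≡ bit b → a ≡ b
bit-injective {false} {false} _ = refl
bit-injective {true}  {true}  _ = refl

odd-bit+2* : ∀ b n → odd (bit b + 2 * n) ≡ b
odd-bit+2* false zero    = refl
odd-bit+2* true  zero    = refl
odd-bit+2* b     (suc n) =
  trans (cong odd (shift (bit b) n)) (trans (not-not _) (odd-bit+2* b n))
  where
  shift : ∀ x n → x + 2 * suc n ≡ suc (suc (x + 2 * n))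
  shift = solve-∀
  not-not : ∀ b → not (not b) ≡ b
  not-not false = refl
  not-not true  = refl

half-bit+2* : ∀ b n → half (bit b + 2 * n) ≡ n
half-bit+2* false zero    = refl
half-bit+2* true  zero    = refl
half-bit+2* b     (suc n) =
  trans (cong half (shift (bit b) n))
 (trans (half-suc-suc (bit b + 2 * n)) (cong suc (half-bit+2* b n)))
  where
  shift : ∀ x n → x + 2 * suc n ≡ suc (suc (x + 2 * n))
  shift = solve-∀
  complementary : ∀ b → bit b + bit (not b) ≡ 1
  complementary false = refl
  complementary true  = refl
  half-suc-suc : ∀ n → half (suc (suc n)) ≡ suc (half n)
  half-suc-suc n = trans (+-assoc (half n) _ _)
                  (trans (cong (half n +_) (complementary (odd n))) (+-comm (half n) 1))

odd+2*half : ∀ n → bit (odd n) + 2 * half n ≡ n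
odd+2*half zero    = refl
odd+2*half (suc n) = trans (step (odd n) (half n)) (cong suc (odd+2*half n))
  where
  step : ∀ b h → bit (not b) + 2 * (h + bit b) ≡ suc (bit b + 2 * h)
  step false = solve-∀
  step true  = solve-∀

halves : ℕ → ℕ → ℕ
halves zero    n = n
halves (suc j) n = half (halves j n)

-- `digit` halves its argument first, whereas a primitive recursion halves the previous result;
-- `digitₚ` computes the former through the latter.
digit-halves : ∀ j n → digit n j ≡ odd (halves j n)
digit-halves zero    n = refl
digit-halves (suc j) n = trans (digit-halves j (half n)) (cong odd (sym (half-halves j n)))
  where
  half-halves : ∀ j n → half (halves j n) ≡ halves j (half n)
  half-halves zero    n = refl
  half-halves (suc j) n = cong half (half-halves j n)

-- The number with the first n bits of X as its lowest digits and v above them: v = 1 marks the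
-- length n, v = 0 gives a finite oracle.
prepend : 2^ω → ℕ → ℕ → ℕ
prepend X zero    v = v
prepend X (suc n) v = bit (X 0) + 2 * prepend (X ∘ suc) n v

-- Recursion at the top digit keeps X fixed, as a primitive recursion with oracle needs; `prepend`
-- shifts X, which suits induction on digits.
low : 2^ω → ℕ → ℕ
low X zero    = 0
low X (suc n) = low X n + 2 ^ n * bit (X n)

prepend≡low : ∀ X n v → prepend X n v ≡ low X n + 2 ^ n * v
prepend≡low X zero    v = sym (+-identityʳ v)
prepend≡low X (suc n) v = begin
  prepend X (suc n) v                            ≡⟨ innermost X n v ⟩
  prepend X n (bit (X n) + 2 * v)                ≡⟨ prepend≡low X n _ ⟩
  low X n + 2 ^ n * (bit (X n) + 2 * v)          ≡⟨ distribute (low X n) (2 ^ n) (bit (X n)) v ⟩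
  low X n + 2 ^ n * bit (X n) + 2 ^ suc n * v    ∎
  where
  open ≡-Reasoning
  innermost : ∀ X n v → prepend X (suc n) v ≡ prepend X n (bit (X n) + 2 * v)
  innermost X zero    v = refl
  innermost X (suc n) v = cong (λ m → bit (X 0) + 2 * m) (innermost (X ∘ suc) n v)
  distribute : ∀ l p b v → l + p * (b + 2 * v) ≡ l + p * b + (2 * p) * v
  distribute = solve-∀

prepend-cong : ∀ {X Z} n v → (∀ {j} → j < n → X j ≡ Z j) → prepend X n v ≡ prepend Z n v
prepend-cong zero    v eq = refl
prepend-cong (suc n) v eq =
  cong₂ (λ b m → bit b + 2 * m) (eq z<s) (prepend-cong n v (λ j<n → eq (s<s j<n)))

digit-prepend-< : ∀ X {n} v {j} → j < n → digit (prepend X n v) j ≡ X j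
digit-prepend-< X {suc n} v {zero}  j<n = odd-bit+2* (X 0) (prepend (X ∘ suc) n v)
digit-prepend-< X {suc n} v {suc j} j<n =
  trans (cong (λ m → digit m j) (half-bit+2* (X 0) _)) (digit-prepend-< (X ∘ suc) v (s<s⁻¹ j<n))

digit-0 : ∀ j → digit 0 j ≡ false
digit-0 zero    = refl
digit-0 (suc j) = digit-0 j

digit-prepend-≥ : ∀ X n {j} → n ≤ j → digit (prepend X n 0) j ≡ false
digit-prepend-≥ X zero    {j}     _   = digit-0 j
digit-prepend-≥ X (suc n) {suc j} n≤j =
  trans (cong (λ m → digit m j) (half-bit+2* (X 0) (prepend (X ∘ suc) n 0))) (digit-prepend-≥ (X ∘ suc) n (s≤s⁻¹ n≤j))

half-< : ∀ {x m} → x < 2 * m → half x < m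
half-< {x} {m} x<2m = *-cancelˡ-< 2 (half x) m
  (≤-<-trans (subst (2 * half x ≤_) (odd+2*half x) (m≤n+m _ (bit (odd x)))) x<2m)

prepend-digit : ∀ {x} n v → x < 2 ^ n → prepend (digit x) n v ≡ x + 2 ^ n * v
prepend-digit {zero}  zero v x<1 = sym (+-identityʳ v)
prepend-digit {suc _} zero v (s≤s ())
prepend-digit {x} (suc n) v x<2^n = begin
  bit (odd x) + 2 * prepend (digit (half x)) n v ≡⟨ cong (λ m → bit (odd x) + 2 * m) (prepend-digit n v (half-< x<2^n)) ⟩
  bit (odd x) + 2 * (half x + 2 ^ n * v)         ≡⟨ regroup (bit (odd x)) (half x) (2 ^ n) v ⟩
  bit (odd x) + 2 * half x + 2 ^ suc n * v       ≡⟨ cong (_+ 2 ^ suc n * v) (odd+2*half x) ⟩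
  x + 2 ^ suc n * v                              ∎
  where
  open ≡-Reasoning
  regroup : ∀ b h p v → b + 2 * (h + p * v) ≡ b + 2 * h + (2 * p) * v
  regroup = solve-∀

prepend-< : ∀ X n {v w} → v < w → prepend X n v < 2 ^ n * w
prepend-< X zero    v<w = subst (_ <_) (sym (+-identityʳ _)) v<w
prepend-< X (suc n) {v} {w} v<w = begin-strict
  bit (X 0) + 2 * prepend (X ∘ suc) n v       <⟨ +-monoˡ-< _ (s≤s (bit≤1 (X 0))) ⟩
  2 + 2 * prepend (X ∘ suc) n v               ≡⟨ *-suc 2 (prepend (X ∘ suc) n v) ⟨
  2 * suc (prepend (X ∘ suc) n v)             ≤⟨ *-monoʳ-≤ 2 (prepend-< (X ∘ suc) n v<w) ⟩
  2 * (2 ^ n * w)                             ≡⟨ *-assoc 2 (2 ^ n) w ⟨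
  2 ^ suc n * w                               ∎
  where open ≤-Reasoning

n<2^n : ∀ n → n < 2 ^ n
n<2^n zero    = ≤-refl
n<2^n (suc n) = begin-strict
  suc n         <⟨ s<s (n<2^n n) ⟩
  1 + 2 ^ n     ≤⟨ +-monoˡ-≤ (2 ^ n) (m^n>0 2 n) ⟩
  2 ^ n + 2 ^ n ≡⟨ cong (2 ^ n +_) (+-identityʳ (2 ^ n)) ⟨
  2 ^ suc n     ∎
  where open ≤-Reasoning

module _ {Y : 2^ω} where

  oddₚ : ∀ {k} → Program Y k → Program Y k
  oddₚ = apply₁ (bit ∘ odd) p eq
    where
    p = rec (lit 0) (lit 1 ∸ₚ var (suc zero))
    eq : ∀ n → ⟦ p ⟧ (n ∷ []) ≡ bit (odd n)
    eq zero    = refl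
    eq (suc n) = trans (cong (1 ∸_) (eq n)) (sym (bit-not (odd n)))

  halfₚ : ∀ {k} → Program Y k → Program Y k
  halfₚ = apply₁ half p eq
    where
    p = rec (lit 0) (var (suc zero) +ₚ oddₚ (var zero))
    eq : ∀ n → ⟦ p ⟧ (n ∷ []) ≡ half n
    eq zero    = refl
    eq (suc n) = cong (_+ bit (odd n)) (eq n)

  digitₚ : ∀ {k} → Program Y k → Program Y k → Program Y k
  digitₚ = apply₂ (λ j n → bit (digit n j)) (oddₚ p) (λ j n → cong bit (eq′ j n))
    where
    p = rec (var zero) (halfₚ (var (suc zero)))
    eq : ∀ j n → ⟦ p ⟧ (j ∷ n ∷ []) ≡ halves j n
    eq zero    n = refl
    eq (suc j) n = cong half (eq j n)
    eq′ : ∀ j n → odd (⟦ p ⟧ (j ∷ n ∷ [])) ≡ digit n j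
    eq′ j n = trans (cong odd (eq j n)) (sym (digit-halves j n))

-- Oracles given by an additional argument

lookup-inject₁ : ∀ {k} (xs : Vec ℕ k) x i → lookup (xs ∷ʳ x) (inject₁ i) ≡ lookup xs i
lookup-inject₁ (_ ∷ xs) x zero    = refl
lookup-inject₁ (_ ∷ xs) x (suc i) = lookup-inject₁ xs x i

lookup-last : ∀ {k} (xs : Vec ℕ k) x → lookup (xs ∷ʳ x) (fromℕ k) ≡ x
lookup-last []       x = refl
lookup-last (_ ∷ xs) x = lookup-last xs x

module _ {Y : 2^ω} where

  mutual
    -- The oracle becomes the finite set of positions of the digits 1 of an added argument. It comes
    -- last because `prec` and `min` put theirs in front.
    internalise : ∀ {k} → Code k → Code (suc k)
    internalise zero        = comp zero []
    internalise succ        = comp succ (proj zero ∷ [])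
    internalise oracle      = code (digitₚ {Y} (var zero) (var (suc zero)))
    internalise (proj i)    = proj (inject₁ i)
    internalise (comp c cs) = comp (internalise c) (internalise* cs)
    internalise (prec c d)  = prec (internalise c) (internalise d)
    internalise (min c)     = min (internalise c)

    internalise* : ∀ {k m} → Vec (Code k) m → Vec (Code (suc k)) (suc m)
    -- The extra component hands the oracle argument on to the outer code.
    internalise* {k} []   = proj (fromℕ k) ∷ []
    internalise* (c ∷ cs) = internalise c ∷ internalise* cs

  module _ {X : 2^ω} {x : ℕ} where

    mutual
      -- All queries lie below the use, so a finite oracle that agrees with X there leads to the
      -- same computation.
      internalised : ∀ {k} {c : Code k} {xs y} (d : X ⊢ c ∙ xs ⇓ y) →
                     (∀ {j} → j < use d → X j ≡ digit x j) → Y ⊢ internalise c ∙ xs ∷ʳ x ⇓ y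
      internalised ⇓zero eq = ⇓comp [] ⇓zero
      internalised ⇓succ eq = ⇓comp (⇓proj ∷ []) ⇓succ
      internalised (⇓oracle {n}) eq =
        subst (λ b → Y ⊢ internalise oracle ∙ n ∷ x ∷ [] ⇓ bit b) (sym (eq ≤-refl))
              (correct (digitₚ (var zero) (var (suc zero))) (n ∷ x ∷ []))
      internalised (⇓proj {i = i} {xs}) eq =
        subst (Y ⊢ proj (inject₁ i) ∙ xs ∷ʳ x ⇓_) (lookup-inject₁ xs x i) ⇓proj
      internalised (⇓comp ds e) eq =
        ⇓comp (internalised* ds (λ j< → eq (m<n⇒m<n⊔o _ j<))) (internalised e (λ j< → eq (m<n⇒m<o⊔n _ j<)))
      internalised (⇓prec-z d) eq = ⇓prec-z (internalised d eq)
      internalised (⇓prec-s d e) eq =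
        ⇓prec-s (internalised d (λ j< → eq (m<n⇒m<n⊔o _ j<))) (internalised e (λ j< → eq (m<n⇒m<o⊔n _ j<)))
      internalised (⇓min s) eq = ⇓min (internalisedˢ s eq)

      internalised* : ∀ {k m} {cs : Vec (Code k) m} {xs ys} (ds : X ⊢ cs ∙ xs ⇓* ys) →
                      (∀ {j} → j < use* ds → X j ≡ digit x j) → Y ⊢ internalise* cs ∙ xs ∷ʳ x ⇓* ys ∷ʳ x
      internalised* {xs = xs} [] eq =
        subst (Y ⊢ proj (fromℕ _) ∙ xs ∷ʳ x ⇓_) (lookup-last xs x) ⇓proj ∷ []
      internalised* (d ∷ ds) eq =
        internalised d (λ j< → eq (m<n⇒m<n⊔o _ j<)) ∷ internalised* ds (λ j< → eq (m<n⇒m<o⊔n _ j<))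

      internalisedˢ : ∀ {k} {c : Code (suc k)} {xs i y} (s : X ⊢ c ∙ xs from i ⇓ y) →
                      (∀ {j} → j < useˢ s → X j ≡ digit x j) →
                      Y ⊢ internalise c ∙ xs ∷ʳ x from i ⇓ y
      internalisedˢ (found d)  eq = found (internalised d eq)
      internalisedˢ (next d s) eq =
        next (internalised d (λ j< → eq (m<n⇒m<n⊔o _ j<))) (internalisedˢ s (λ j< → eq (m<n⇒m<o⊔n _ j<)))

  -- The number 0 codes the empty oracle; supplying it carries a computation from `∅` over to any
  -- oracle.
  relativise : ∀ {f} → Computable f → Program Y 1
  relativise {f} (c , d) = record
    { code    = comp (internalise c) (proj zero ∷ code (lit {Y} 0) ∷ [])
    ; ⟦_⟧     = λ { (n ∷ []) → f n }
    ; correct = λ { (n ∷ []) → ⇓comp (⇓proj ∷ correct (lit 0) (n ∷ []) ∷ [])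
                                     (internalised (d n) (λ {j} _ → sym (digit-0 j))) }
    }

  accumulate : Program Y 3
  accumulate = var (suc zero) +ₚ 2^ₚ var zero *ₚ var (suc (suc zero))

  -- A code and not a `Program`, because c may be partial: it has to converge only on the positions
  -- below n.
  lowCode : Code 2 → Code 2
  lowCode c = prec (code (lit {Y} 0)) (comp (code accumulate) (proj zero ∷ proj (suc zero) ∷ bitCode ∷ []))
    where
    bitCode : Code 3
    bitCode = comp c (proj zero ∷ proj (suc (suc zero)) ∷ [])

  lowCode-correct : ∀ {c x Z} n → (∀ {j} → j < n → Y ⊢ c ∙ j ∷ x ∷ [] ⇓ bit (Z j)) →
                    Y ⊢ lowCode c ∙ n ∷ x ∷ [] ⇓ low Z n
  lowCode-correct zero    d = ⇓prec-z (correct (lit 0) _)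
  lowCode-correct (suc n) d = ⇓prec-s (lowCode-correct n (λ j<n → d (m<n⇒m<1+n j<n)))
    (⇓comp (⇓proj ∷ ⇓proj ∷ ⇓comp (⇓proj ∷ ⇓proj ∷ []) (d ≤-refl) ∷ []) (correct accumulate _))

-- Strings

-- One more than the bijective base-2 code is ordinary binary with a leading 1 above the bits; this
-- reduces the next lemmas to digits.
suc-⌜∷⌝ : ∀ b σ → suc ⌜ b ∷ σ ⌝ ≡ bit b + 2 * suc ⌜ σ ⌝
suc-⌜∷⌝ false σ = sym (*-suc 2 ⌜ σ ⌝)
suc-⌜∷⌝ true  σ = cong suc (sym (*-suc 2 ⌜ σ ⌝))

⌜⌝-injective : ∀ {σ τ} → ⌜ σ ⌝ ≡ ⌜ τ ⌝ → σ ≡ τ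
⌜⌝-injective {[]}        {[]}        eq = refl
⌜⌝-injective {[]}        {false ∷ _} ()
⌜⌝-injective {[]}        {true ∷ _}  ()
⌜⌝-injective {false ∷ _} {[]}        ()
⌜⌝-injective {true ∷ _}  {[]}        ()
⌜⌝-injective {a ∷ σ}     {b ∷ τ}     eq = cong₂ _∷_ heads (⌜⌝-injective (suc-injective tails))
  where
  eq′ : bit a + 2 * suc ⌜ σ ⌝ ≡ bit b + 2 * suc ⌜ τ ⌝
  eq′ = trans (sym (suc-⌜∷⌝ a σ)) (trans (cong suc eq) (suc-⌜∷⌝ b τ))
  heads : a ≡ b
  heads = trans (sym (odd-bit+2* a (suc ⌜ σ ⌝))) (trans (cong odd eq′) (odd-bit+2* b (suc ⌜ τ ⌝)))
  tails : suc ⌜ σ ⌝ ≡ suc ⌜ τ ⌝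
  tails = trans (sym (half-bit+2* a (suc ⌜ σ ⌝))) (trans (cong half eq′) (half-bit+2* b (suc ⌜ τ ⌝)))

suc-⌜↾⌝ : ∀ X n → suc ⌜ X ↾ n ⌝ ≡ prepend X n 1
suc-⌜↾⌝ X zero    = refl
suc-⌜↾⌝ X (suc n) = trans (suc-⌜∷⌝ (X 0) _) (cong (λ m → bit (X 0) + 2 * m) (suc-⌜↾⌝ (X ∘ suc) n))

⌜↾⌝-low : ∀ X n → ⌜ X ↾ n ⌝ ≡ pred (low X n + 2 ^ n)
⌜↾⌝-low X n = cong pred (trans (suc-⌜↾⌝ X n) (trans (prepend≡low X n 1) (cong (low X n +_) (*-identityʳ _))))

⌜⌝-< : ∀ σ → suc ⌜ σ ⌝ < 2 ^ suc (length σ)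
⌜⌝-< []      = ≤-refl
⌜⌝-< (b ∷ σ) = begin-strict
  suc ⌜ b ∷ σ ⌝              ≡⟨ suc-⌜∷⌝ b σ ⟩
  bit b + 2 * suc ⌜ σ ⌝      <⟨ +-monoˡ-< _ (s≤s (bit≤1 b)) ⟩
  2 + 2 * suc ⌜ σ ⌝          ≡⟨ *-suc 2 (suc ⌜ σ ⌝) ⟨
  2 * suc (suc ⌜ σ ⌝)        ≤⟨ *-monoʳ-≤ 2 (⌜⌝-< σ) ⟩
  2 ^ suc (length (b ∷ σ))   ∎
  where open ≤-Reasoning

↾-≡ : ∀ {X Z} n → X ↾ n ≡ Z ↾ n → ∀ {j} → j < n → X j ≡ Z j
↾-≡ (suc n) eq {zero}  _   = ∷-injectiveˡ eq
↾-≡ (suc n) eq {suc j} j<n = ↾-≡ n (∷-injectiveʳ eq) (s<s⁻¹ j<n)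

-- Self-delimiting descriptions

trues : ℕ → ℕ → ℕ
trues zero    n = n
trues (suc q) n = 2 + 2 * trues q n

⌜replicate⌝ : ∀ q σ → ⌜ replicate q true ++ σ ⌝ ≡ trues q ⌜ σ ⌝
⌜replicate⌝ zero    σ = refl
⌜replicate⌝ (suc q) σ = cong (λ n → 2 + 2 * n) (⌜replicate⌝ q σ)

⌜digit↾⌝ : ∀ {p} l → p < 2 ^ l → ⌜ digit p ↾ l ⌝ ≡ pred (p + 2 ^ l)
⌜digit↾⌝ {p} l p<2^l = cong pred (trans (suc-⌜↾⌝ (digit p) l)
  (trans (prepend-digit l 1 p<2^l) (cong (p +_) (*-identityʳ (2 ^ l)))))

prefix-refl : ∀ (σ : List Bool) → Prefix _≡_ σ σ
prefix-refl []      = []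
prefix-refl (_ ∷ σ) = refl ∷ prefix-refl σ

prefix-↾ : ∀ {X Z} n → Prefix _≡_ (X ↾ n) (Z ↾ n) → X ↾ n ≡ Z ↾ n
prefix-↾ zero    []           = refl
prefix-↾ (suc n) (eq ∷ pre) = cong₂ _∷_ eq (prefix-↾ n pre)

-- The first `false` ends the unary header, so comparable strings have equal headers.
unary-prefix : ∀ q q′ {σ σ′} → Prefix _≡_ (replicate q true ++ false ∷ σ) (replicate q′ true ++ false ∷ σ′) →
               q ≡ q′ × Prefix _≡_ σ σ′
unary-prefix zero    zero     (_ ∷ pre)  = refl , pre
unary-prefix zero    (suc q′) (() ∷ _)
unary-prefix (suc q) zero     (() ∷ _)
unary-prefix (suc q) (suc q′) (_ ∷ pre)  with refl , pre′ ← unary-prefix q q′ pre = refl , pre′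

-- A number p is written in q blocks of 1 + m binary digits, with q least possible,
-- preceded by q in unary.

module BlockCode (m : ℕ) where

  chunks-least : ∀ p → ∃[ q ] Least (λ q → suc p ∸ 2 ^ (q * suc m)) q
  chunks-least p = findLeast _ (p , m≤n⇒m∸n≡0 (≤-trans (n<2^n p) (^-monoʳ-≤ 2 (m≤m*n p (suc m)))))

  chunks : ℕ → ℕ
  chunks p = proj₁ (chunks-least p)

  chunks-≤ : ∀ p q → p < 2 ^ (q * suc m) → chunks p ≤ q
  chunks-≤ p q p<2^l = Least-≤ (proj₂ (chunks-least p)) (m≤n⇒m∸n≡0 p<2^l)

  <2^chunks : ∀ p → p < 2 ^ (chunks p * suc m)
  <2^chunks p = m∸n≡0⇒m≤n (zeroAt (proj₂ (chunks-least p)))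

  encode : ℕ → List Bool
  encode p = replicate (chunks p) true ++ false ∷ (digit p ↾ (chunks p * suc m))

  length-encode : ∀ p → length (encode p) ≡ suc (chunks p + chunks p * suc m)
  length-encode p = trans (length-++ (replicate (chunks p) true))
    (trans (cong₂ (λ a b → a + suc b) (length-replicate (chunks p)) (length-applyUpTo (digit p) _)) (+-suc _ _))

  ⌜encode⌝ : ∀ p → ⌜ encode p ⌝ ≡ trues (chunks p) (1 + 2 * pred (p + 2 ^ (chunks p * suc m)))
  ⌜encode⌝ p = trans (⌜replicate⌝ (chunks p) _)
    (cong (λ n → trues (chunks p) (1 + 2 * n)) (⌜digit↾⌝ (chunks p * suc m) (<2^chunks p)))

  -- The header fixes the length of the body, a prefix of equal length is the whole body, and the
  -- body determines p.
  encode-prefix : ∀ p p′ → Prefix _≡_ (encode p) (encode p′) → p ≡ p′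
  encode-prefix p p′ pre = +-cancelʳ-≡ (2 ^ l * 1) p p′ (begin
    p + 2 ^ l * 1        ≡⟨ prepend-digit l 1 (<2^chunks p) ⟨
    prepend (digit p) l 1      ≡⟨ suc-⌜↾⌝ (digit p) l ⟨
    suc ⌜ digit p ↾ l ⌝        ≡⟨ cong (λ σ → suc ⌜ σ ⌝) (prefix-↾ l tails) ⟩
    suc ⌜ digit p′ ↾ l ⌝       ≡⟨ suc-⌜↾⌝ (digit p′) l ⟩
    prepend (digit p′) l 1     ≡⟨ prepend-digit l 1 (subst (λ q → p′ < 2 ^ (q * suc m)) (sym chunks≡) (<2^chunks p′)) ⟩
    p′ + 2 ^ l * 1             ∎)
    where
    open ≡-Reasoning
    l = chunks p * suc m
    chunks≡ : chunks p ≡ chunks p′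
    chunks≡ = proj₁ (unary-prefix (chunks p) (chunks p′) pre)
    tails : Prefix _≡_ (digit p ↾ l) (digit p′ ↾ l)
    tails = subst (λ q → Prefix _≡_ (digit p ↾ l) (digit p′ ↾ (q * suc m))) (sym chunks≡)
                  (proj₂ (unary-prefix (chunks p) (chunks p′) pre))

  encode-injective : ∀ p p′ → ⌜ encode p ⌝ ≡ ⌜ encode p′ ⌝ → p ≡ p′
  encode-injective p p′ eq =
    encode-prefix p p′ (subst (Prefix _≡_ (encode p)) (⌜⌝-injective eq) (prefix-refl (encode p)))

  encodeₚ : Program ∅ 1
  encodeₚ = computing (truesₚ q (lit 1 +ₚ lit 2 *ₚ predₚ (var zero +ₚ 2^ₚ (q *ₚ lit (suc m)))))
                      (λ { (p ∷ []) → ⌜ encode p ⌝ }) (λ { (p ∷ []) → sym (⌜encode⌝ p) })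
    where
    q : Program ∅ 1
    q = search (sucₚ (var (suc zero)) ∸ₚ 2^ₚ (var zero *ₚ lit (suc m))) (λ { (p ∷ []) → chunks-least p })
    r : Program ∅ 2
    r = rec (var zero) (lit 2 +ₚ lit 2 *ₚ var (suc zero))
    eq : ∀ q n → ⟦ r ⟧ (q ∷ n ∷ []) ≡ trues q n
    eq zero    n = refl
    eq (suc q) n = cong (λ n → 2 + 2 * n) (eq q n)
    truesₚ : Program ∅ 1 → Program ∅ 1 → Program ∅ 1
    truesₚ = apply₂ trues r eq

  distanceTo : Program ∅ 2
  distanceTo = distance (call encodeₚ (var zero ∷ [])) (var (suc zero))

  decoding : Code 1 → Code 1
  decoding Ψ = comp Ψ (min (code distanceTo) ∷ [])

  -- A search that halts has found a zero of the distance. Thus only code words are in the domain,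
  -- which makes the machine prefix-free for every Ψ.
  decoding-domain : ∀ {Ψ σ τ} → decoding Ψ ⟨ σ ⟩≃ τ → ∃[ p ] σ ≡ encode p
  decoding-domain {Ψ} {σ} (⇓comp (_∷_ {y = p} (⇓min s) []) _) =
    p , sym (⌜⌝-injective (distance≡0 _ _
          (⇓-deterministic (correct distanceTo (p ∷ ⌜ σ ⌝ ∷ [])) (from-⇓0 s))))

  decoding-prefixFree : ∀ Ψ → PrefixFree (decoding Ψ)
  decoding-prefixFree Ψ {σ} {σ′} {τ} {τ′} d d′ pre
    with p , refl ← decoding-domain {Ψ} {σ} {τ} d | p′ , refl ← decoding-domain {Ψ} {σ′} {τ′} d′ =
    cong encode (encode-prefix p p′ pre)

  decoding-encode : ∀ {Ψ p y} → ∅ ⊢ Ψ ∙ p ∷ [] ⇓ ⌜ y ⌝ → decoding Ψ ⟨ encode p ⟩≃ y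
  decoding-encode {Ψ} {p} d =
    ⇓comp (⇓min (from-least (λ i → correct distanceTo (i ∷ ⌜ encode p ⌝ ∷ [])) least-p) ∷ []) d
    where
    least-p : Least (λ i → ⟦ distanceTo ⟧ (i ∷ ⌜ encode p ⌝ ∷ [])) p
    least-p = least (distance-refl ⌜ encode p ⌝)
      (λ {j} j<p eq → <⇒≢ j<p (encode-injective j p (distance≡0 _ _ eq)))

  -- The header costs one bit per block, so l digits take about l + l / (1 + m) bits: a ratio near 1
  -- for large m, and 2 for m = 0.
  short-programs : ∀ {U} → UniversalPrefixFree U → ∀ Ψ →
    ∃[ c ] (∀ {p y} q → ∅ ⊢ Ψ ∙ p ∷ [] ⇓ ⌜ y ⌝ → p < 2 ^ (q * suc m) →
            ∃[ ρ ] (U ⟨ ρ ⟩≃ y × length ρ ≤ suc (q + q * suc m) + c))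
  short-programs {U} univ Ψ =
    proj₁ simulation , λ {p} {y} q d p<2^l →
      let ρ , e , |ρ|≤ = proj₂ simulation (encode p) y (decoding-encode {Ψ} {p} {y} d)
          q′≤q = chunks-≤ p q p<2^l
      in ρ , e , ≤-trans |ρ|≤ (+-monoˡ-≤ _ (subst (_≤ suc (q + q * suc m)) (sym (length-encode p))
                   (s≤s (+-mono-≤ q′≤q (*-monoˡ-≤ (suc m) q′≤q)))))
    where
    simulation : ∃[ c ] (∀ σ τ → decoding Ψ ⟨ σ ⟩≃ τ → ∃[ ρ ] (U ⟨ ρ ⟩≃ τ × length ρ ≤ length σ + c))
    simulation = UniversalPrefixFree.universal univ (decoding Ψ)
      (λ {σ} {σ′} {τ} {τ′} → decoding-prefixFree Ψ {σ} {σ′} {τ} {τ′})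

-- Incompressible blocks

module Classical (em : ExcludedMiddle 0ℓ) where

  stable : {P : Set} → ¬ ¬ P → P
  stable = decidable-stable em

  least-satisfying : (P : ℕ → Set) → ∃[ n ] P n → ∃[ n ] (P n × (∀ {j} → P j → n ≤ j))
  least-satisfying P (n , Pn) =
    let k , l = findLeast χ (n , χ-zero Pn) in k , χ-true (zeroAt l) , λ Pj → Least-≤ l (χ-zero Pj)
    where
    χ : ℕ → ℕ
    χ n = if does (em {P n}) then 0 else 1
    χ-zero : ∀ {n} → P n → χ n ≡ 0
    χ-zero {n} Pn with em {P n}
    ... | yes _  = refl
    ... | no ¬Pn = contradiction Pn ¬Pn
    χ-true : ∀ {n} → χ n ≡ 0 → P n
    χ-true {n} eq with em {P n}
    ... | yes Pn = Pn

  abstract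

    -- The identity on codes, with blocks of one digit, yields some program for y; excluded middle
    -- selects a shortest one.
    complexity-exists : ∀ {U} → UniversalPrefixFree U → ∀ y → ∃[ k ] K[ U ] y ≡ k
    complexity-exists {U} univ y =
      let ρ , d , _ = proj₂ (BlockCode.short-programs 0 univ (proj zero)) {⌜ y ⌝} {y} ⌜ y ⌝ ⇓proj
                        (subst (λ l → ⌜ y ⌝ < 2 ^ l) (sym (*-identityʳ ⌜ y ⌝)) (n<2^n ⌜ y ⌝))
          k , program , minimal = least-satisfying (λ k → ∃[ σ ] (U ⟨ σ ⟩≃ y × length σ ≡ k)) (length ρ , ρ , d , refl)
      in k , program , λ σ e → minimal (σ , e , refl)

  -- The bound has to hold whatever X is below r, so the string for each block can be chosen
  -- independently of the others.
  Incompressible : Code 1 → ℕ → ℕ → 2^ω → Set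
  Incompressible U r L w = ∀ X → (∀ {j} → r ≤ j → j < r + L → X j ≡ w j) →
                           ∀ σ → U ⟨ σ ⟩≃ (X ↾ (r + L)) → L ≤ length σ

  -- There are fewer programs shorter than L than blocks of length L, and a program
  -- determines the block.

  incompressible : ∀ U r L → ∃[ w ] Incompressible U r L w
  incompressible U r L = stable λ none →
    let w                = λ i j → digit i (j ∸ r)
        bad              = λ i → stable (λ good → none (w i , λ X X≈w σ d →
                             ≮⇒≥ (λ short → good (X , σ , X≈w , d , short))))
        -- Strings shorter than L have codes below 2 ^ L - 1, one value fewer than there are
        -- candidate blocks.
        i , j , i<j , eq = pigeonhole (subst (pred (2 ^ L) <_) (suc-pred (2 ^ L) {{m^n≢0 2 L}}) ≤-refl)
                                      (λ i → short⇒Fin (bad (toℕ i)))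
    in <⇒≢ i<j (program-determines (toℕ<n i) (toℕ<n j) (bad (toℕ i)) (bad (toℕ j)) eq)
    where
    Bad : ℕ → Set
    Bad i = Σ[ X ∈ 2^ω ] ∃[ σ ] ((∀ {j} → r ≤ j → j < r + L → X j ≡ digit i (j ∸ r)) ×
                                 U ⟨ σ ⟩≃ (X ↾ (r + L)) × length σ < L)

    bound : ∀ {i} (b : Bad i) → ⌜ proj₁ (proj₂ b) ⌝ < pred (2 ^ L)
    bound (_ , σ , _ , _ , short) = pred-mono-≤ (≤-trans (⌜⌝-< σ) (^-monoʳ-≤ 2 short))

    short⇒Fin : ∀ {i} → Bad i → Fin (pred (2 ^ L))
    short⇒Fin b = fromℕ< (bound b)

    program-determines : ∀ {i i′} → i < 2 ^ L → i′ < 2 ^ L → (b : Bad i) (b′ : Bad i′) →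
                         short⇒Fin b ≡ short⇒Fin b′ → i ≡ i′
    program-determines {i} {i′} i< i′< b@(X , σ , X≈ , d , _) b′@(X′ , σ′ , X′≈ , d′ , _) eq =
      +-cancelʳ-≡ (2 ^ L * 0) i i′ (trans (sym (prepend-digit L 0 i<))
        (trans (prepend-cong L 0 digits) (prepend-digit L 0 i′<)))
      where
      σ≡σ′ : ⌜ σ ⌝ ≡ ⌜ σ′ ⌝
      σ≡σ′ = trans (sym (toℕ-fromℕ< (bound b))) (trans (cong toℕ eq) (toℕ-fromℕ< (bound b′)))
      outputs : X ↾ (r + L) ≡ X′ ↾ (r + L)
      outputs = ⌜⌝-injective (⇓-deterministic d
                  (subst (λ n → ∅ ⊢ U ∙ n ∷ [] ⇓ ⌜ X′ ↾ (r + L) ⌝) (sym σ≡σ′) d′))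
      digits : ∀ {j} → j < L → digit i j ≡ digit i′ j
      digits {j} j<L = subst (λ k → digit i k ≡ digit i′ k) (m+n∸m≡n r j)
        (trans (sym (X≈ (m≤m+n r j) (+-monoʳ-< r j<L)))
        (trans (↾-≡ (r + L) outputs (+-monoʳ-< r j<L)) (X′≈ (m≤m+n r j) (+-monoʳ-< r j<L))))

-- The blocks

stepwise-mono : ∀ (g : ℕ → ℕ) → (∀ n → g n ≤ g (suc n)) → ∀ {m n} → m ≤ n → g m ≤ g n
stepwise-mono g step m≤n = go (≤⇒≤′ m≤n)
  where
  go : ∀ {m n} → m ≤′ n → g m ≤ g n
  go (≤′-reflexive refl) = ≤-refl
  go (≤′-step m≤n)       = ≤-trans (go m≤n) (step _)

-- Block c is [start c, start (1 + c)); inside it lies the active part [opens c, closes c).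
-- If f bounds the use of an operator, the first n values depend on the oracle below reach n only.

module Blocks (f : ℕ → ℕ) where

  -- A sum in place of a maximum: it dominates each f j with j < n and is visibly monotone, at least
  -- n and primitive recursive in f.
  reach : ℕ → ℕ
  reach zero    = 0
  reach (suc n) = suc (reach n + f n)

  -- The active part opens beyond all queries for values below `start c`. The factor `suc c` in
  -- `closes c` makes it long against what precedes it; as `start (suc c)` is `suc c * closes c`,
  -- all of this is in turn short against any n in the next block.
  start opens closes : ℕ → ℕ
  start zero    = 0
  start (suc c) = suc c * (suc c * suc (reach (start c)))
  opens c  = reach (start c)
  closes c = suc c * suc (opens c)

  n≤reach : ∀ n → n ≤ reach n
  n≤reach zero    = z≤n
  n≤reach (suc n) = s≤s (≤-trans (n≤reach n) (m≤m+n _ _))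

  reach-mono : ∀ {m n} → m ≤ n → reach m ≤ reach n
  reach-mono = stepwise-mono reach (λ n → m≤n⇒m≤1+n (m≤m+n (reach n) (f n)))

  f≤reach : ∀ {j n} → j < n → f j ≤ reach n
  f≤reach {j} j<n = ≤-trans (m≤n⇒m≤1+n (m≤n+m (f j) (reach j))) (reach-mono j<n)

  start≤opens : ∀ c → start c ≤ opens c
  start≤opens c = n≤reach (start c)

  opens<closes : ∀ c → opens c < closes c
  opens<closes c = m≤m+n (suc (opens c)) _

  c<closes : ∀ c → c < closes c
  c<closes c = m≤m*n (suc c) (suc (opens c))

  closes≤start : ∀ c → closes c ≤ start (suc c)
  closes≤start c = m≤m+n (closes c) _

  opens≤start : ∀ c → opens c ≤ start (suc c)
  opens≤start c = ≤-trans (<⇒≤ (opens<closes c)) (closes≤start c)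

  start-mono : ∀ {c d} → c ≤ d → start c ≤ start d
  start-mono = stepwise-mono start (λ c → ≤-trans (start≤opens c) (opens≤start c))

  opens-mono : ∀ {c d} → c ≤ d → opens c ≤ opens d
  opens-mono c≤d = reach-mono (start-mono c≤d)

  closes-mono : ∀ {c d} → c ≤ d → closes c ≤ closes d
  closes-mono c≤d = *-mono-≤ (s≤s c≤d) (s≤s (opens-mono c≤d))

  blockOf-least : ∀ n → ∃[ c ] Least (λ c → suc n ∸ start (suc c)) c
  blockOf-least n = findLeast _ (n , m≤n⇒m∸n≡0 (≤-trans (c<closes n) (closes≤start n)))

  blockOf : ℕ → ℕ
  blockOf n = proj₁ (blockOf-least n)

  <start-blockOf : ∀ n → n < start (suc (blockOf n))
  <start-blockOf n = m∸n≡0⇒m≤n (zeroAt (proj₂ (blockOf-least n)))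

  start-blockOf≤ : ∀ n → start (blockOf n) ≤ n
  start-blockOf≤ n with blockOf-least n
  ... | zero  , _ = z≤n
  ... | suc c , l = ≮⇒≥ (λ n< → minimal l ≤-refl (m≤n⇒m∸n≡0 n<))

  blockOf-≥ : ∀ {c n} → start c ≤ n → c ≤ blockOf n
  blockOf-≥ {c} {n} start≤n =
    ≮⇒≥ (λ b<c → <⇒≱ (<start-blockOf n) (≤-trans (start-mono b<c) start≤n))

  blockOf-unique : ∀ {c n} → start c ≤ n → n < start (suc c) → blockOf n ≡ c
  blockOf-unique {c} {n} start≤n n<start =
    ≤-antisym (Least-≤ (proj₂ (blockOf-least n)) (m≤n⇒m∸n≡0 n<start)) (blockOf-≥ start≤n)

  module _ (S : ℕ → Bool) (w : ℕ → 2^ω) where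

    sparse : 2^ω
    sparse j = S c ∧ ((opens c ≤ᵇ j) ∧ ((suc j ≤ᵇ closes c) ∧ w c j))
      where c = blockOf j

    sparse-active : ∀ {c j} → S c ≡ true → opens c ≤ j → j < closes c → sparse j ≡ w c j
    sparse-active {c} {j} Sc opens≤j j<closes
      rewrite blockOf-unique {c} (≤-trans (start≤opens c) opens≤j) (≤-trans j<closes (closes≤start c))
            | Sc | Equivalence.to T-≡ (≤⇒≤ᵇ opens≤j) | Equivalence.to T-≡ (≤⇒≤ᵇ j<closes) = refl

    sparse-true : ∀ {j} → sparse j ≡ true →
                  S (blockOf j) ≡ true × opens (blockOf j) ≤ j × j < closes (blockOf j)
    sparse-true {j} eq
      with S (blockOf j) | opens (blockOf j) ≤ᵇ j in o | suc j ≤ᵇ closes (blockOf j) in cl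
    ... | true | true | true = refl , ≤ᵇ⇒≤ _ _ (Equivalence.from T-≡ o) , ≤ᵇ⇒≤ _ _ (Equivalence.from T-≡ cl)

    -- Active parts up to block c end by `closes c`, those from block c + 2 on begin at
    -- `opens (2 + c)` or later, and S omits the block between.
    sparse-quiet : ∀ {c j} → S (suc c) ≡ false → closes c ≤ j → j < opens (2 + c) → sparse j ≡ false
    sparse-quiet {c} {j} Sc closes≤j j<opens with sparse j in eq
    ... | false = refl
    ... | true  with sparse-true {j} eq | <-cmp (blockOf j) (suc c)
    ...   | _ , _ , j<closes | tri< b<1+c _ _ =
            contradiction (≤-trans (closes-mono (s≤s⁻¹ b<1+c)) closes≤j) (<⇒≱ j<closes)
    ...   | _ , opens≤j , _ | tri> _ _ b>1+c =
            contradiction (≤-trans (opens-mono b>1+c) opens≤j) (<⇒≱ j<opens)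
    ...   | Sb , _ | tri≈ _ b≡1+c _ with () ← trans (sym Sb) (trans (cong S b≡1+c) Sc)

-- Programs for the block functions

module _ {Y : 2^ω} (f : Program Y 1) where

  open Blocks (λ n → ⟦ f ⟧ (n ∷ []))

  private
    reachₚ : Program Y 1
    reachₚ = rec (lit 0) (sucₚ (var (suc zero) +ₚ call f (var zero ∷ [])))

    reachₚ-correct : ∀ n → ⟦ reachₚ ⟧ (n ∷ []) ≡ reach n
    reachₚ-correct zero    = refl
    reachₚ-correct (suc n) = cong (λ m → suc (m + ⟦ f ⟧ (n ∷ []))) (reachₚ-correct n)

    nextₚ : ∀ {k} → Program Y k → Program Y k → Program Y k
    nextₚ c n = sucₚ c *ₚ sucₚ (apply₁ reach reachₚ reachₚ-correct n)

  startₚ : ∀ {k} → Program Y k → Program Y k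
  startₚ = apply₁ start p eq
    where
    p = rec (lit 0) (sucₚ (var zero) *ₚ nextₚ (var zero) (var (suc zero)))
    eq : ∀ c → ⟦ p ⟧ (c ∷ []) ≡ start c
    eq zero    = refl
    eq (suc c) = cong (λ n → suc c * (suc c * suc (reach n))) (eq c)

  closesₚ : ∀ {k} → Program Y k → Program Y k
  closesₚ = apply₁ closes (nextₚ (var zero) (startₚ (var zero))) (λ c → refl)

  blockOfₚ : ∀ {k} → Program Y k → Program Y k
  blockOfₚ = apply₁ blockOf (search (sucₚ (var (suc zero)) ∸ₚ startₚ (sucₚ (var zero)))
                                    (λ { (n ∷ []) → blockOf-least n })) (λ n → refl)

-- Decidable ranges of monotone functions

bit-≡ᵇ : ∀ m n → 1 ∸ ((m ∸ n) + (n ∸ m)) ≡ bit (m ≡ᵇ n)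
bit-≡ᵇ zero    zero    = refl
bit-≡ᵇ zero    (suc n) = 0∸n≡0 n
bit-≡ᵇ (suc m) zero    = 0∸n≡0 (m + 0)
bit-≡ᵇ (suc m) (suc n) = bit-≡ᵇ m n

module Range {G : ℕ → ℕ} (mono : ∀ {m n} → m ≤ n → G m ≤ G n) (inflationary : ∀ n → n ≤ G n) where

  rank-least : ∀ n → ∃[ k ] Least (λ k → n ∸ G k) k
  rank-least n = findLeast _ (n , m≤n⇒m∸n≡0 (inflationary n))

  rank : ℕ → ℕ
  rank n = proj₁ (rank-least n)

  -- By monotonicity n can only be the value at the first k with n ≤ G k, so a single comparison
  -- decides membership.
  range : 2^ω
  range n = n ≡ᵇ G (rank n)

  range-G : ∀ k → range (G k) ≡ true
  range-G k = Equivalence.to T-≡ (≡⇒≡ᵇ _ _ (≤-antisym (m∸n≡0⇒m≤n (zeroAt l)) (mono (Least-≤ l (n∸n≡0 (G k))))))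
    where
    l = proj₂ (rank-least (G k))

  range-∈ : ∀ n → range n ≡ true → ∃[ k ] n ≡ G k
  range-∈ n eq = rank n , ≡ᵇ⇒≡ n _ (Equivalence.from T-≡ eq)

  range-Δ : ∀ {Y} (g : Program Y 1) → (∀ k → ⟦ g ⟧ (k ∷ []) ≡ G k) → InfiniteΔ⁰₁ Y
  range-Δ {Y} g eq = record
    { set        = range
    ; infinite   = λ m → G m , inflationary m , range-G m
    ; computable = code p , λ n → subst (Y ⊢ code p ∙ n ∷ [] ⇓_) (bit-≡ᵇ n (G (rank n))) (correct p (n ∷ []))
    }
    where
    rankₚ : Program Y 1
    rankₚ = search (var (suc zero) ∸ₚ apply₁ G g eq (var zero)) (λ { (n ∷ []) → rank-least n })
    p : Program Y 1
    p = lit 1 ∸ₚ distance (var zero) (apply₁ G g eq rankₚ)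

-- Comparison of rationals with quotients

module _ {r : ℚ.ℚ} {k n : ℕ} .{{_ : NonZero n}} where

  cross-< : r ℚ.< (ℤ.+ k) ℚ./ n → ↥ r ℤ.* ℤ.+ n ℤ.< ℤ.+ k ℤ.* ↧ r
  cross-< = go r n
    where
    go : ∀ r n .{{_ : NonZero n}} → r ℚ.< (ℤ.+ k) ℚ./ n → ↥ r ℤ.* ℤ.+ n ℤ.< ℤ.+ k ℤ.* ↧ r
    go r@record{} (suc n) r< = ℚᵘ.drop-*<* (ℚᵘ.<-respʳ-≃ (ℚ.toℚᵘ-fromℚᵘ (ℚᵘ.mkℚᵘ (ℤ.+ k) n)) (ℚ.toℚᵘ-mono-< {p = r} r<))

  uncross-< : ↥ r ℤ.* ℤ.+ n ℤ.< ℤ.+ k ℤ.* ↧ r → r ℚ.< (ℤ.+ k) ℚ./ n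
  uncross-< = go r n
    where
    go : ∀ r n .{{_ : NonZero n}} → ↥ r ℤ.* ℤ.+ n ℤ.< ℤ.+ k ℤ.* ↧ r → r ℚ.< (ℤ.+ k) ℚ./ n
    go r@record{} (suc n) r< = ℚ.toℚᵘ-cancel-< {p = r}
      (ℚᵘ.<-respʳ-≃ (ℚᵘ.≃-sym (ℚ.toℚᵘ-fromℚᵘ (ℚᵘ.mkℚᵘ (ℤ.+ k) n))) (ℚᵘ.*<* r<))

  numerator-≤ : ∀ {a} → ℤ.+ a ℤ.≤ ↥ r → r ℚ.< (ℤ.+ k) ℚ./ n → a * n < k * ↧ₙ r
  numerator-≤ {a} a≤ r< = ℤ.drop‿+<+ (begin-strict
    ℤ.+ (a * n)          ≡⟨ ℤ.pos-* a n ⟩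
    ℤ.+ a ℤ.* ℤ.+ n        ≤⟨ ℤ.*-monoʳ-≤-nonNeg (ℤ.+ n) a≤ ⟩
    ↥ r ℤ.* ℤ.+ n        <⟨ cross-< r< ⟩
    ℤ.+ k ℤ.* ↧ r        ≡⟨ ℤ.pos-* k (↧ₙ r) ⟨
    ℤ.+ (k * ↧ₙ r)       ∎)
    where open ℤ.≤-Reasoning

  numerator-≥ : ∀ {a} → ↥ r ℤ.≤ ℤ.+ a → a * n < k * ↧ₙ r → r ℚ.< (ℤ.+ k) ℚ./ n
  numerator-≥ {a} ≤a an< = uncross-< (begin-strict
    ↥ r ℤ.* ℤ.+ n        ≤⟨ ℤ.*-monoʳ-≤-nonNeg (ℤ.+ n) ≤a ⟩
    ℤ.+ a ℤ.* ℤ.+ n        ≡⟨ ℤ.pos-* a n ⟨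
    ℤ.+ (a * n)          <⟨ ℤ.+<+ an< ⟩
    ℤ.+ (k * ↧ₙ r)       ≡⟨ ℤ.pos-* k (↧ₙ r) ⟩
    ℤ.+ k ℤ.* ↧ r        ∎)
    where open ℤ.≤-Reasoning

  -- By integrality the numerator of r is at least its denominator plus 1, a gap for the complexity
  -- estimates to contradict. The cases r > 0, r < 1 and r < 0 below are alike.
  1<r⇒ : 1ℚ ℚ.< r → r ℚ.< (ℤ.+ k) ℚ./ n → suc (↧ₙ r) * n < k * ↧ₙ r
  1<r⇒ (ℚ.*<* 1<r) = numerator-≤ (ℤ.i<j⇒suc[i]≤j
    (subst₂ ℤ._<_ (ℤ.*-identityˡ (↧ r)) (ℤ.*-identityʳ (↥ r)) 1<r))

  0<r⇒ : 0ℚ ℚ.< r → r ℚ.< (ℤ.+ k) ℚ./ n → n < k * ↧ₙ r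
  0<r⇒ (ℚ.*<* 0<r) r< = subst (_< k * ↧ₙ r) (*-identityˡ n) (numerator-≤ (ℤ.i<j⇒suc[i]≤j
    (subst₂ ℤ._<_ (ℤ.*-zeroˡ (↧ r)) (ℤ.*-identityʳ (↥ r)) 0<r)) r<)

  r<1⇒ : r ℚ.< 1ℚ → pred (↧ₙ r) * n < k * ↧ₙ r → r ℚ.< (ℤ.+ k) ℚ./ n
  r<1⇒ (ℚ.*<* r<1) = numerator-≥ (ℤ.i<j⇒i≤pred[j]
    (subst₂ ℤ._<_ (ℤ.*-identityʳ (↥ r)) (ℤ.*-identityˡ (↧ r)) r<1))

  r<0⇒ : r ℚ.< 0ℚ → r ℚ.< (ℤ.+ k) ℚ./ n
  r<0⇒ (ℚ.*<* r<0) = uncross-< (begin-strict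
    ↥ r ℤ.* ℤ.+ n        ≤⟨ ℤ.*-monoʳ-≤-nonNeg (ℤ.+ n) (ℤ.i<j⇒i≤pred[j]
                            (subst₂ ℤ._<_ (ℤ.*-identityʳ (↥ r)) (ℤ.*-zeroˡ (↧ r)) r<0)) ⟩
    -1ℤ ℤ.* ℤ.+ n        <⟨ negative n ⟩
    0ℤ                 ≤⟨ ℤ.+≤+ z≤n ⟩
    ℤ.+ (k * ↧ₙ r)       ≡⟨ ℤ.pos-* k (↧ₙ r) ⟩
    ℤ.+ k ℤ.* ↧ r        ∎)
    where
    open ℤ.≤-Reasoning
    negative : ∀ n .{{_ : NonZero n}} → -1ℤ ℤ.* ℤ.+ n ℤ.< 0ℤ
    negative (suc n) = ℤ.-<+

-- Pairing

divide : ∀ m n → ∃[ h ] (suc m * h ≤ n × n < suc m * suc h)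
divide m n = n / suc m , subst (_≤ n) (*-comm (n / suc m) (suc m)) (m/n*n≤m n (suc m)) ,
  (begin-strict
    n                                    ≡⟨ m≡m%n+[m/n]*n n (suc m) ⟩
    n % suc m + n / suc m * suc m        <⟨ +-monoˡ-< (n / suc m * suc m) (m%n<n n (suc m)) ⟩
    suc (n / suc m) * suc m              ≡⟨ *-comm (suc (n / suc m)) (suc m) ⟩
    suc m * suc (n / suc m)              ∎)
  where open ≤-Reasoning

-- With m = 1 + m′ and h = n / m the square (h + 1)² exceeds n and is at most 2^(2h).

logarithm-≤ : ∀ m′ {n} → suc m′ * suc m′ ≤ n → ∃[ l ] (suc m′ * l ≤ 2 * n × n < 2 ^ l)
logarithm-≤ m′ {n} m²≤n with h , mh≤n , n<m[1+h] ← divide m′ n =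
  h + h ,
  (begin
    m * (h + h)       ≡⟨ double m h ⟩
    2 * (m * h)       ≤⟨ *-monoʳ-≤ 2 mh≤n ⟩
    2 * n             ∎) ,
  (begin-strict
    n                 <⟨ n<m[1+h] ⟩
    m * suc h         ≤⟨ *-monoˡ-≤ (suc h) (<⇒≤ (*-cancelˡ-< m m (suc h) (≤-<-trans m²≤n n<m[1+h]))) ⟩
    suc h * suc h     ≤⟨ *-mono-≤ (n<2^n h) (n<2^n h) ⟩
    2 ^ h * 2 ^ h     ≡⟨ ^-distribˡ-+-* 2 h h ⟨
    2 ^ (h + h)       ∎)
  where
  open ≤-Reasoning
  m = suc m′
  double : ∀ m h → m * (h + h) ≡ 2 * (m * h)
  double = solve-∀

-- The value lies between consecutive squares: its integer root is x + n and the excess over the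
-- square is x. Quadratic growth at most about doubles the number of digits of x + n.
pair : ℕ → ℕ → ℕ
pair x n = (x + n) * (x + n) + x

pair-< : ∀ x n → pair x n < suc (x + n) * suc (x + n)
pair-< x n = begin-strict
  t * t + x               ≤⟨ +-monoʳ-≤ (t * t) (m≤m+n x n) ⟩
  t * t + t               <⟨ s≤s (m≤m+n (t * t + t) t) ⟩
  suc (t * t + t + t)     ≡⟨ square t ⟩
  suc t * suc t           ∎
  where
  open ≤-Reasoning
  t = x + n
  square : ∀ t → suc (t * t + t + t) ≡ suc t * suc t
  square = solve-∀

pair-<-2^ : ∀ {x n s l} → x < 2 ^ s → n < 2 ^ l → let q = suc (s + l) in pair x n < 2 ^ (q + q)
pair-<-2^ {x} {n} {s} {l} x< n< = begin-strict
  pair x n                        <⟨ pair-< x n ⟩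
  suc (x + n) * suc (x + n)       ≤⟨ *-mono-≤ x+n< x+n< ⟩
  2 ^ q * 2 ^ q                   ≡⟨ ^-distribˡ-+-* 2 q q ⟨
  2 ^ (q + q)                     ∎
  where
  open ≤-Reasoning
  q = suc (s + l)
  x+n< : x + n < 2 ^ q
  x+n< = begin
    suc x + n                     ≤⟨ +-mono-≤ x< (<⇒≤ n<) ⟩
    2 ^ s + 2 ^ l                 ≤⟨ +-mono-≤ (^-monoʳ-≤ 2 (m≤m+n s l)) (^-monoʳ-≤ 2 (m≤n+m l s)) ⟩
    2 ^ (s + l) + 2 ^ (s + l)     ≡⟨ cong (2 ^ (s + l) +_) (+-identityʳ (2 ^ (s + l))) ⟨
    2 ^ q                         ∎

root-least : ∀ p → ∃[ t ] Least (λ t → suc p ∸ suc t * suc t) t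
root-least p = findLeast _ (p , m≤n⇒m∸n≡0 (m≤m*n (suc p) (suc p)))

root : ℕ → ℕ
root p = proj₁ (root-least p)

root-pair : ∀ x n → root (pair x n) ≡ x + n
root-pair x n = ≤-antisym (Least-≤ l (m≤n⇒m∸n≡0 (pair-< x n))) (≮⇒≥ λ root< →
  <⇒≱ (m∸n≡0⇒m≤n (zeroAt l)) (≤-trans (*-mono-≤ root< root<) (m≤m+n ((x + n) * (x + n)) x)))
  where
  l = proj₂ (root-least (pair x n))

module _ {Y : 2^ω} where

  private
    rootₚ excessₚ : Program Y 1
    rootₚ   = search (sucₚ (var (suc zero)) ∸ₚ sucₚ (var zero) *ₚ sucₚ (var zero)) (λ { (p ∷ []) → root-least p })
    excessₚ = var zero ∸ₚ rootₚ *ₚ rootₚ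

  unpairˡ unpairʳ : Program Y 1
  unpairˡ = excessₚ
  unpairʳ = rootₚ ∸ₚ excessₚ

  unpairˡ-pair : ∀ x n → ⟦ unpairˡ ⟧ (pair x n ∷ []) ≡ x
  unpairˡ-pair x n rewrite root-pair x n = m+n∸m≡n ((x + n) * (x + n)) x

  unpairʳ-pair : ∀ x n → ⟦ unpairʳ ⟧ (pair x n ∷ []) ≡ n
  unpairʳ-pair x n = trans (cong₂ _∸_ (root-pair x n) (unpairˡ-pair x n)) (m+n∸m≡n x n)

⌜↾⌝-<-2^ : ∀ Z {n l} → n < l → ⌜ Z ↾ n ⌝ < 2 ^ l
⌜↾⌝-<-2^ Z {n} {l} n<l = <-trans (n<1+n ⌜ Z ↾ n ⌝) (≤-trans (⌜⌝-< (Z ↾ n))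
  (^-monoʳ-≤ 2 (subst (λ a → suc a ≤ l) (sym (length-applyUpTo Z n)) n<l)))

-- Arithmetic of program lengths

overhead : ℕ → ℕ → ℕ
overhead m c = m * suc c + m + m * m

-- This is K ≤ n + n / m + O(1), multiplied by m to avoid fractions, for a description in `suc h`
-- blocks of m digits.
blocks-overhead : ∀ m {h n c k} → m * h ≤ n → k ≤ suc (suc h + suc h * m) + c → m * k ≤ m * n + n + overhead m c
blocks-overhead m {h} {n} {c} {k} mh≤n k≤ = begin
  m * k                                   ≤⟨ *-monoʳ-≤ m k≤ ⟩
  m * (suc (suc h + suc h * m) + c)       ≡⟨ expand m h c ⟩
  m * (m * h) + m * h + overhead m c      ≤⟨ +-monoˡ-≤ (overhead m c) (+-mono-≤ (*-monoʳ-≤ m mh≤n) mh≤n) ⟩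
  m * n + n + overhead m c                ∎
  where
  open ≤-Reasoning
  expand : ∀ m h c → m * (suc (suc h + suc h * m) + c) ≡ m * (m * h) + m * h + (m * suc c + m + m * m)
  expand = solve-∀

-- The sparse sequence X

-- Put D = `suc D′` and m = 2 * D. An excess of k over n above n / D has to fit into n / m + C / m,
-- and n / D is twice n / m.
no-excess : ∀ D′ {n k C} → suc (suc D′) * n < k * suc D′ →
            suc (suc (2 * D′)) * k ≤ suc (suc (2 * D′)) * n + n + C → n ≤ C
no-excess D′ {n} {k} {C} n<k k≤n = +-cancelˡ-≤ (2 * (suc D′ * n) + n) n C (begin
  2 * (suc D′ * n) + n + n            ≡⟨ double (suc D′) n ⟩
  2 * (suc (suc D′) * n)              ≤⟨ *-monoʳ-≤ 2 (<⇒≤ n<k) ⟩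
  2 * (k * suc D′)                    ≡⟨ cong (2 *_) (*-comm k (suc D′)) ⟩
  2 * (suc D′ * k)                    ≡⟨ evenly D′ k ⟨
  suc (suc (2 * D′)) * k              ≤⟨ k≤n ⟩
  suc (suc (2 * D′)) * n + n + C      ≡⟨ cong (λ e → e + n + C) (evenly D′ n) ⟩
  2 * (suc D′ * n) + n + C            ∎)
  where
  open ≤-Reasoning
  double : ∀ D n → 2 * (D * n) + n + n ≡ 2 * (suc D * n)
  double = solve-∀
  evenly : ∀ D′ n → suc (suc (2 * D′)) * n ≡ 2 * (suc D′ * n)
  evenly = solve-∀

module PrefixDecoder where

  oracleₚ lengthₚ : Program ∅ 1
  oracleₚ = unpairˡ
  lengthₚ = unpairʳ

  -- Adds the leading 1 above n given digits and subtracts 1, which yields the code of the string.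
  suffixed : Program ∅ 2
  suffixed = predₚ (var zero +ₚ 2^ₚ var (suc zero))

-- The bound of `short-programs` with one-digit blocks for a pair of numbers below 2 ^ s and 2 ^ l;
-- the pair has at most q + q digits.
pairOverhead : ℕ → ℕ → ℕ → ℕ
pairOverhead s l C = let q = suc (s + l) in suc (q + q + (q + q) * 1) + C

-- The bound on k equals 4 * s + 4 * l + 5 + C, and the hypotheses make D times each of 4 * s, 4 * l
-- and 5 + C at most n / 3.
small-quotient : ∀ D′ {k s l n C} → let D = suc D′ in k ≤ pairOverhead s l C →
                 12 * D * s ≤ n → suc (24 * D) * l ≤ 2 * n → 3 * D * (5 + C) ≤ n → k * D ≤ n
small-quotient D′ {k} {s} {l} {n} {C} k≤ s≤ l≤ C≤ = *-cancelˡ-≤ 6 (begin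
  6 * (k * D)                                                  ≤⟨ *-monoʳ-≤ 6 (*-monoˡ-≤ D k≤) ⟩
  6 * (pairOverhead s l C * D)                                 ≡⟨ expand D s l C ⟩
  2 * (3 * D * (5 + C)) + 2 * (12 * D * s) + 24 * D * l        ≤⟨ +-mono-≤ (+-mono-≤ (*-monoʳ-≤ 2 C≤) (*-monoʳ-≤ 2 s≤))
                                                                    (≤-trans (*-monoˡ-≤ l (n≤1+n (24 * D))) l≤) ⟩
  2 * n + 2 * n + 2 * n                                        ≡⟨ collect n ⟩
  6 * n                                                        ∎)
  where
  open ≤-Reasoning
  D = suc D′
  expand : ∀ D s l C → 6 * ((suc (suc (s + l) + suc (s + l) + (suc (s + l) + suc (s + l)) * 1) + C) * D) ≡
                       2 * (3 * D * (5 + C)) + 2 * (12 * D * s) + 24 * D * l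
  expand = solve-∀
  collect : ∀ n → 2 * n + 2 * n + 2 * n ≡ 6 * n
  collect = solve-∀

module Construction (em : ExcludedMiddle 0ℓ) {U : Code 1} (univ : UniversalPrefixFree U)
                    (A : 2^ω) (Φ : WttReduction) where

  open Classical em
  open WttReduction Φ
  open Blocks bound

  boundₚ : ∀ {Y} → Program Y 1
  boundₚ = relativise computable

  prefixNumber : ℕ → ℕ
  prefixNumber k = prepend A k 1

  prefixNumber-low : ∀ k → prefixNumber k ≡ low A k + 2 ^ k
  prefixNumber-low k = trans (prepend≡low A k 1) (cong (low A k +_) (*-identityʳ (2 ^ k)))

  prefixNumber-mono : ∀ {m n} → m ≤ n → prefixNumber m ≤ prefixNumber n
  prefixNumber-mono = stepwise-mono prefixNumber λ n →
    subst₂ _≤_ (sym (prefixNumber-low n)) (sym (prefixNumber-low (suc n)))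
           (+-mono-≤ (m≤m+n (low A n) _) (^-monoʳ-≤ 2 (n≤1+n n)))

  n<prefixNumber : ∀ n → n < prefixNumber n
  n<prefixNumber n = subst (n <_) (sym (prefixNumber-low n)) (<-≤-trans (n<2^n n) (m≤n+m (2 ^ n) (low A n)))

  prefixNumber-< : ∀ k → prefixNumber k < 2 ^ suc k
  prefixNumber-< k = subst (prefixNumber k <_) (*-comm (2 ^ k) 2) (prepend-< A k {1} {2} ≤-refl)

  prefixNumberₚ : Program A 1
  prefixNumberₚ = computing (lowₚ +ₚ 2^ₚ var zero) (λ { (k ∷ []) → prefixNumber k })
                            (λ { (k ∷ []) → sym (prefixNumber-low k) })
    where
    lowₚ : Program A 1
    lowₚ = record
      { code    = comp (lowCode {A} (comp oracle (proj zero ∷ []))) (proj zero ∷ code (lit {A} 0) ∷ [])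
      ; ⟦_⟧     = λ { (k ∷ []) → low A k }
      ; correct = λ { (k ∷ []) → ⇓comp (⇓proj ∷ correct (lit {A} 0) (k ∷ []) ∷ [])
                                       (lowCode-correct k (λ _ → ⇓comp (⇓proj ∷ []) ⇓oracle)) }
      }

  -- Decided by excluded middle; computability from A is asked only of the ends `closes c` of chosen
  -- blocks.
  IsPrefixNumber : ℕ → Bool
  IsPrefixNumber c = does (em {∃[ k ] c ≡ prefixNumber k})

  isPrefixNumber : ∀ k → IsPrefixNumber (prefixNumber k) ≡ true
  isPrefixNumber k with em {∃[ l ] prefixNumber k ≡ prefixNumber l}
  ... | yes _ = refl
  ... | no ¬p = contradiction (k , refl) ¬p

  isPrefixNumber⁻¹ : ∀ {c} → IsPrefixNumber c ≡ true → ∃[ k ] c ≡ prefixNumber k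
  isPrefixNumber⁻¹ {c} eq with em {∃[ k ] c ≡ prefixNumber k}
  ... | yes p = p

  activeLength : ℕ → ℕ
  activeLength c = closes c ∸ opens c

  filling : ℕ → 2^ω
  filling c = proj₁ (incompressible U (opens c) (activeLength c))

  X : 2^ω
  X = sparse IsPrefixNumber filling

  -- Less than a fraction 1 / (c + 1) of `closes c` precedes `opens c`, so k is more than the
  -- fraction 1 - 1 / D of `closes c`, where D = `suc D′`.
  nearly-incompressible : ∀ D′ {c k} → D′ ≤ c → closes c ≤ opens c + k → D′ * closes c < k * suc D′
  nearly-incompressible D′ {c} {k} D′≤c closes≤ = +-cancelʳ-< (closes c) (D′ * closes c) (k * suc D′) (begin-strict
    D′ * closes c + closes c            ≡⟨ +-comm (D′ * closes c) (closes c) ⟩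
    suc D′ * closes c                   ≤⟨ *-monoʳ-≤ (suc D′) closes≤ ⟩
    suc D′ * (opens c + k)              ≡⟨ distribute (suc D′) (opens c) k ⟩
    k * suc D′ + suc D′ * opens c       <⟨ +-monoʳ-< (k * suc D′) (*-monoʳ-< (suc D′) (n<1+n (opens c))) ⟩
    k * suc D′ + suc D′ * suc (opens c) ≤⟨ +-monoʳ-≤ (k * suc D′) (*-monoˡ-≤ (suc (opens c)) (s≤s D′≤c)) ⟩
    k * suc D′ + closes c               ∎)
    where
    open ≤-Reasoning
    distribute : ∀ D o k → D * (o + k) ≡ k * D + D * o
    distribute = solve-∀

  complexity-closes : ∀ {c k} → IsPrefixNumber c ≡ true → K[ U ] (X ↾ closes c) ≡ k → closes c ≤ opens c + k
  complexity-closes {c} {k} Sc ((σ , d , |σ|≡k) , _) = ≤-trans (m≤n+m∸n (closes c) (opens c)) (+-monoʳ-≤ (opens c)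
    (subst (activeLength c ≤_) |σ|≡k
      (proj₂ (incompressible U (opens c) (activeLength c)) X
        (λ {j} opens≤j j< → sparse-active IsPrefixNumber filling {c} Sc opens≤j (subst (j <_) end j<))
        σ (subst (λ n → U ⟨ σ ⟩≃ (X ↾ n)) (sym end) d))))
    where
    end : opens c + activeLength c ≡ closes c
    end = m+[n∸m]≡n (<⇒≤ (opens<closes c))

  complexity-upper : ∀ m′ → let m = suc m′ in
    ∃[ C ] (∀ Z n {k} → K[ U ] (Z ↾ n) ≡ k → m * k ≤ m * n + n + C)
  complexity-upper m′ = overhead (suc m′) c , bounded
    where
    c = proj₁ (BlockCode.short-programs m′ univ (proj zero))
    bounded : ∀ Z n {k} → K[ U ] (Z ↾ n) ≡ k → suc m′ * k ≤ suc m′ * n + n + overhead (suc m′) c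
    bounded Z n {k} K≡k =
      let h , mh≤n , n< = divide m′ n
          n<l           = subst (n <_) (*-comm (suc m′) (suc h)) n<
          ρ , d , |ρ|≤  = proj₂ (BlockCode.short-programs m′ univ (proj zero)) {⌜ Z ↾ n ⌝} {Z ↾ n} (suc h) ⇓proj
                            (⌜↾⌝-<-2^ Z n<l)
      in blocks-overhead (suc m′) mh≤n (≤-trans (proj₂ K≡k ρ d) |ρ|≤)

  -- The dimension of X relative to A

  dim-X : dim-siΔ⁰₁ U A X ≈ fromℚ 1ℚ
  dim-X q = mk⇔ below above
    where
    below : dim-siΔ⁰₁ U A X q → q ℚ.< 1ℚ
    below (N , r , q<r , r<value) = ℚ.≰⇒> λ 1≤q → <⇒≱ C<n
      (no-excess (ℚ.ℚ.denominator-1 r) {n} {k} (1<r⇒ {r} {k} {n} (ℚ.≤-<-trans 1≤q q<r) (r<value p))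
        (proj₂ upper X n K≡k))
      where
      -- The argument is m - 1 for m = 2 * D, with D the denominator of r, as `no-excess` requires.
      upper = complexity-upper (suc (2 * ℚ.ℚ.denominator-1 r))
      C = proj₁ upper
      far = InfiniteΔ⁰₁.infinite N (suc C)
      n = proj₁ far
      C<n : C < n
      C<n = proj₁ (proj₂ far)
      k = proj₁ (complexity-exists univ (X ↾ n))
      K≡k = proj₂ (complexity-exists univ (X ↾ n))
      instance
        n≢0 : NonZero n
        n≢0 = >-nonZero (≤-trans (s≤s z≤n) C<n)
      p : Quotient U X (InfiniteΔ⁰₁.set N)
      p = record { n = n ; n∈N = proj₂ (proj₂ far) ; k = k ; complexity = K≡k }

    above : q ℚ.< 1ℚ → dim-siΔ⁰₁ U A X q
    above q<1 = range-Δ g (λ _ → refl) , r , proj₁ (proj₂ (ℚ.<-dense q<1)) , r<value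
      where
      -- The infimum asks for a rational strictly above q that is below all quotients.
      r = proj₁ (ℚ.<-dense q<1)
      r<1 = proj₂ (proj₂ (ℚ.<-dense q<1))
      D′ = ℚ.ℚ.denominator-1 r
      -- The shift by D′ discards small blocks: the block numbers exceed D′, so the quotients exceed
      -- D′ / (D′ + 1), which is at least r.
      c : ℕ → ℕ
      c k = prefixNumber (D′ + k)
      g : Program A 1
      g = closesₚ boundₚ (call prefixNumberₚ (lit D′ +ₚ var zero ∷ []))
      mono : ∀ {m n} → m ≤ n → closes (c m) ≤ closes (c n)
      mono {m} {n} m≤n = closes-mono {c m} {c n} (prefixNumber-mono (+-monoʳ-≤ D′ m≤n))
      D′+k<c : ∀ k → D′ + k < c k
      D′+k<c k = n<prefixNumber (D′ + k)
      inflationary : ∀ k → k ≤ closes (c k)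
      inflationary k = ≤-trans (m≤n+m k D′) (<⇒≤ (<-trans (D′+k<c k) (c<closes (c k))))
      open Range {λ k → closes (c k)} mono inflationary
      r<value : (p : Quotient U X range) → r ℚ.< Quotient.value p
      r<value p = r<1⇒ {r} {k} {n} r<1 (subst (λ n → D′ * n < k * suc D′) (sym n≡closes)
        (nearly-incompressible D′ {c i} {k} (≤-trans (m≤m+n D′ i) (<⇒≤ (D′+k<c i)))
          (complexity-closes {c i} (isPrefixNumber (D′ + i))
            (subst (λ n → K[ U ] (X ↾ n) ≡ k) n≡closes complexity))))
        where
        open Quotient p
        i = proj₁ (range-∈ n n∈N)
        n≡closes : n ≡ closes (c i)
        n≡closes = proj₂ (range-∈ n n∈N)

  non-total⊎Z : ¬ Total machine X ⊎ (Σ[ Z ∈ 2^ω ] machine [ X ]≐ Z)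
  non-total⊎Z = [ (λ total → inj₂ (decide total)) , inj₁ ]′ (toSum em)
    where
    decide : Total machine X → Σ[ Z ∈ 2^ω ] machine [ X ]≐ Z
    decide total = (λ n → proj₁ (binary (proj₂ (total n)))) ,
      λ n → subst (X ⊢ machine ∙ n ∷ [] ⇓_) (proj₂ (binary (proj₂ (total n)))) (proj₂ (total n))

  -- B-computable sets and the unchosen blocks

  module _ {B : 2^ω} (A≰B : ¬ (A ≤T B)) where

    -- If almost all elements of N lay in blocks numbered by prefixes of A, the digit j of A
    -- could be read off the block number of any sufficiently large element of N.

    outside-prefixNumbers : (N : InfiniteΔ⁰₁ B) → let open InfiniteΔ⁰₁ N in
      ∀ m → ∃[ n ] (m ≤ n × set n ≡ true × IsPrefixNumber (blockOf n) ≡ false)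
    outside-prefixNumbers N m = stable λ none → A≰B (code A-from-N , λ j →
        subst (λ b → B ⊢ code A-from-N ∙ j ∷ [] ⇓ bit b) (digit≡A none j) (correct A-from-N (j ∷ [])))
      where
      open InfiniteΔ⁰₁ N renaming (computable to set-computable)

      setₚ : Program B 1
      setₚ = record { code = proj₁ set-computable ; ⟦_⟧ = λ { (n ∷ []) → bit (set n) }
                    ; correct = λ { (n ∷ []) → proj₂ set-computable n } }

      -- Beyond m the assumption `none` applies; beyond `start (2 ^ suc j)` the block number is at
      -- least 2 ^ (j + 1), so as a prefix number it shows more than j digits of A.
      threshold : ℕ → ℕ
      threshold j = m + start (2 ^ suc j)

      test : ℕ → ℕ → ℕ
      test n j = (1 ∸ bit (set n)) + (threshold j ∸ n)

      large-element : ∀ j → ∃[ n ] Least (λ n → test n j) n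
      large-element j = let n , large , n∈N = infinite (threshold j) in
        findLeast _ (n , cong₂ _+_ (cong (λ b → 1 ∸ bit b) n∈N) (m≤n⇒m∸n≡0 large))

      element : ℕ → ℕ
      element j = proj₁ (large-element j)

      element∈N : ∀ j → set (element j) ≡ true
      element∈N j = bit-injective (≤-antisym (bit≤1 _)
        (m∸n≡0⇒m≤n (m+n≡0⇒m≡0 _ (zeroAt (proj₂ (large-element j))))))

      threshold≤element : ∀ j → threshold j ≤ element j
      threshold≤element j = m∸n≡0⇒m≤n (m+n≡0⇒n≡0 (1 ∸ bit (set (element j))) (zeroAt (proj₂ (large-element j))))

      -- Total because N is infinite; the assumption to be refuted enters only in showing that the
      -- output is A.
      A-from-N : Program B 1
      A-from-N = digitₚ (var zero) (blockOfₚ boundₚ elementₚ)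
        where
        elementₚ : Program B 1
        elementₚ = search ((lit 1 ∸ₚ call setₚ (var zero ∷ [])) +ₚ
                           ((lit m +ₚ startₚ boundₚ (2^ₚ sucₚ (var (suc zero)))) ∸ₚ var zero))
                          (λ { (j ∷ []) → large-element j })

      digit≡A : ¬ (∃[ n ] (m ≤ n × set n ≡ true × IsPrefixNumber (blockOf n) ≡ false)) →
                ∀ j → digit (blockOf (element j)) j ≡ A j
      digit≡A none j = trans (cong (λ c → digit c j) block≡) (digit-prepend-< A 1 j<k)
        where
        n = element j
        isPrefix : IsPrefixNumber (blockOf n) ≡ true
        isPrefix = ¬-not (λ eq → none (n , ≤-trans (m≤m+n m _) (threshold≤element j) , element∈N j , eq))
        k = proj₁ (isPrefixNumber⁻¹ isPrefix)
        block≡ : blockOf n ≡ prefixNumber k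
        block≡ = proj₂ (isPrefixNumber⁻¹ isPrefix)
        j<k : j < k
        j<k = ≰⇒> λ k≤j → <⇒≱ (prefixNumber-< k)
          (≤-trans (^-monoʳ-≤ 2 (s≤s k≤j))
                   (subst (2 ^ suc j ≤_) block≡ (blockOf-≥ {2 ^ suc j} {n} (≤-trans (m≤n+m _ m) (threshold≤element j)))))

  -- Complexity and dimension of the image

  decodePrefix : Code 1
  decodePrefix = comp (code suffixed) (comp (lowCode {∅} (internalise {∅} machine)) (code lengthₚ ∷ code oracleₚ ∷ []) ∷
                                       code lengthₚ ∷ [])
    where
    open PrefixDecoder

  module _ {Z : 2^ω} (computes-Z : machine [ X ]≐ Z) where

    decodePrefix-correct : ∀ x n → (∀ {j} → j < reach n → X j ≡ digit x j) →
                           ∅ ⊢ decodePrefix ∙ pair x n ∷ [] ⇓ ⌜ Z ↾ n ⌝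
    decodePrefix-correct x n X≈x =
      subst (∅ ⊢ decodePrefix ∙ pair x n ∷ [] ⇓_) (sym (⌜↾⌝-low Z n))
        (⇓comp (⇓comp (evalʳ ∷ evalˡ ∷ []) (lowCode-correct n Z-digit) ∷ evalʳ ∷ [])
               (correct suffixed (low Z n ∷ n ∷ [])))
      where
      open PrefixDecoder
      evalˡ : ∅ ⊢ code oracleₚ ∙ pair x n ∷ [] ⇓ x
      evalˡ = subst (∅ ⊢ code oracleₚ ∙ pair x n ∷ [] ⇓_) (unpairˡ-pair {∅} x n) (correct oracleₚ (pair x n ∷ []))
      evalʳ : ∅ ⊢ code lengthₚ ∙ pair x n ∷ [] ⇓ n
      evalʳ = subst (∅ ⊢ code lengthₚ ∙ pair x n ∷ [] ⇓_) (unpairʳ-pair {∅} x n) (correct lengthₚ (pair x n ∷ []))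
      Z-digit : ∀ {j} → j < n → ∅ ⊢ internalise {∅} machine ∙ j ∷ x ∷ [] ⇓ bit (Z j)
      Z-digit {j} j<n = internalised (computes-Z j)
        (λ i< → X≈x (<-≤-trans i< (≤-trans (use≤bound (computes-Z j)) (f≤reach j<n))))

    -- From n < `start (2 + c)` follows `reach n` ≤ `opens (2 + c)`; up to there X vanishes from
    -- `closes c` on, so its bits below `closes c` answer every query.
    quiet-prefix : ∀ {c n} → IsPrefixNumber (suc c) ≡ false → blockOf n ≡ suc c →
                   ∀ {j} → j < reach n → X j ≡ digit (prepend X (closes c) 0) j
    quiet-prefix {c} {n} S≡ block≡ {j} j< = [ below , above ]′ (<-≤-connex j (closes c))
      where
      below : j < closes c → X j ≡ digit (prepend X (closes c) 0) j
      below j<closes = sym (digit-prepend-< X {closes c} 0 j<closes)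
      above : closes c ≤ j → X j ≡ digit (prepend X (closes c) 0) j
      above closes≤j = trans
        (sparse-quiet IsPrefixNumber filling {c} S≡ closes≤j (<-≤-trans j<
          (reach-mono (<⇒≤ (subst (λ b → n < start (suc b)) block≡ (<start-blockOf n))))))
        (sym (digit-prepend-≥ X (closes c) closes≤j))

    complexity-Z : ∃[ C ] (∀ {c n l k} → IsPrefixNumber (suc c) ≡ false → blockOf n ≡ suc c → n < 2 ^ l →
                           K[ U ] (Z ↾ n) ≡ k → k ≤ pairOverhead (closes c) l C)
    complexity-Z = C , bounded
      where
      -- A constant factor does no harm to dimension 0, so blocks of one digit suffice.
      programs = BlockCode.short-programs 0 univ decodePrefix
      C = proj₁ programs
      bounded : ∀ {c n l k} → IsPrefixNumber (suc c) ≡ false → blockOf n ≡ suc c → n < 2 ^ l →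
                K[ U ] (Z ↾ n) ≡ k → k ≤ pairOverhead (closes c) l C
      bounded {c} {n} {l} S≡ block≡ n< K≡k =
        let x           = prepend X (closes c) 0
            q           = suc (closes c + l)
            x<          = subst (x <_) (*-identityʳ (2 ^ closes c)) (prepend-< X (closes c) {0} {1} ≤-refl)
            ρ , d , |ρ|≤ = proj₂ programs {pair x n} {Z ↾ n} (q + q)
                            (decodePrefix-correct x n (quiet-prefix {c} {n} S≡ block≡))
                            (subst (λ e → pair x n < 2 ^ e) (sym (*-identityʳ (q + q)))
                                   (pair-<-2^ {x} {n} {closes c} {l} x< n<))
        in ≤-trans (proj₂ K≡k ρ d) |ρ|≤

    dim-Z : ∀ {B} → ¬ (A ≤T B) → dim-siΔ⁰₁ U B Z ≈ fromℚ 0ℚ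
    dim-Z {B} A≰B q = mk⇔ below above
      where
      below : dim-siΔ⁰₁ U B Z q → q ℚ.< 0ℚ
      below (N , r , q<r , r<value) = ℚ.≰⇒> λ 0≤q → <⇒≱
        (0<r⇒ {r} {k} {n} (ℚ.≤-<-trans 0≤q q<r) (r<value p))
        (small-quotient D′ {k} {closes c} {l} {n} {C}
          (proj₂ complexity-Z {c} {n} {l} {k} S≡ block≡ n<2^l K≡k) closes≤ l≤ C≤)
        where
        D′ = ℚ.ℚ.denominator-1 r
        C = proj₁ complexity-Z
        -- The thresholds of `small-quotient` for the copied part of X, for the digits of n and for
        -- the constant; m₂ is a successor as `logarithm-≤` requires.
        m₁ = 12 * suc D′
        m₂ = suc (24 * suc D′)
        m₃ = 3 * suc D′ * (5 + C)
        element = outside-prefixNumbers A≰B N (start m₁ + (m₂ * m₂ + m₃))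
        n = proj₁ element
        large : start m₁ + (m₂ * m₂ + m₃) ≤ n
        large = proj₁ (proj₂ element)
        m₁≤block : m₁ ≤ blockOf n
        m₁≤block = blockOf-≥ {m₁} {n} (≤-trans (m≤m+n (start m₁) _) large)
        -- The block number is positive, so a preceding block exists, and its end bounds the part of
        -- X to be copied.
        c = pred (blockOf n)
        block≡ : blockOf n ≡ suc c
        block≡ = sym (suc-pred (blockOf n) {{>-nonZero (≤-trans (s≤s z≤n) m₁≤block)}})
        S≡ : IsPrefixNumber (suc c) ≡ false
        S≡ = subst (λ b → IsPrefixNumber b ≡ false) block≡ (proj₂ (proj₂ (proj₂ element)))
        closes≤ : m₁ * closes c ≤ n
        -- Here `start (suc c)` unfolds to `suc c * closes c`.
        closes≤ = ≤-trans (*-monoˡ-≤ (closes c) (subst (m₁ ≤_) block≡ m₁≤block))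
                          (subst (λ b → start b ≤ n) block≡ (start-blockOf≤ n))
        m₂²+m₃≤n : m₂ * m₂ + m₃ ≤ n
        m₂²+m₃≤n = ≤-trans (m≤n+m _ (start m₁)) large
        C≤ : m₃ ≤ n
        C≤ = ≤-trans (m≤n+m m₃ (m₂ * m₂)) m₂²+m₃≤n
        m₂²≤n : m₂ * m₂ ≤ n
        m₂²≤n = ≤-trans (m≤m+n (m₂ * m₂) m₃) m₂²+m₃≤n
        log = logarithm-≤ (24 * suc D′) {n} m₂²≤n
        l = proj₁ log
        l≤ : m₂ * l ≤ 2 * n
        l≤ = proj₁ (proj₂ log)
        n<2^l : n < 2 ^ l
        n<2^l = proj₂ (proj₂ log)
        k = proj₁ (complexity-exists univ (Z ↾ n))
        K≡k : K[ U ] (Z ↾ n) ≡ k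
        K≡k = proj₂ (complexity-exists univ (Z ↾ n))
        instance
          n≢0 : NonZero n
          n≢0 = >-nonZero (≤-trans (s≤s z≤n) m₂²≤n)
        p : Quotient U Z (InfiniteΔ⁰₁.set N)
        p = record { n = n ; n∈N = proj₁ (proj₂ (proj₂ element)) ; k = k ; complexity = K≡k }

      above : q ℚ.< 0ℚ → dim-siΔ⁰₁ U B Z q
      -- Quotients are never negative, so the set of all numbers serves.
      above q<0 = everything , proj₁ middle , proj₁ (proj₂ middle) , λ p →
        r<0⇒ {proj₁ middle} {Quotient.k p} {Quotient.n p} (proj₂ (proj₂ middle))
        where
        middle = ℚ.<-dense q<0
        everything : InfiniteΔ⁰₁ B
        everything = record
          { set        = λ _ → true
          ; infinite   = λ m → m , ≤-refl , refl
          ; computable = code (lit {B} 1) , λ n → correct (lit {B} 1) (n ∷ [])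
          }

theorem14 : ExcludedMiddle 0ℓ →
    (U : Code 1) → UniversalPrefixFree U →
    (A B : 2^ω) → ¬ (A ≤T B) →
    (Φ : WttReduction) →
    Σ[ X ∈ 2^ω ]
    (dim-siΔ⁰₁ U A X ≈ fromℚ 1ℚ ×
    (¬ Total (WttReduction.machine Φ) X ⊎
    Σ[ Z ∈ 2^ω ]
    (WttReduction.machine Φ [ X ]≐ Z × dim-siΔ⁰₁ U B Z ≈ fromℚ 0ℚ)))
theorem14 em U univ A B A≰B Φ =
  X , dim-X , map₂ (λ { (Z , computes-Z) → Z , computes-Z , dim-Z computes-Z A≰B }) non-total⊎Z
  where
  open Construction em univ A Φ
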